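{- There is an absolute constant $C$ such that, for any proper edge-coloring of $K_n$ which uses at most $Kn$ colors, there is a spanning tree of $K_n$ whose edges use at most $CK\log(n/K)$ distinct colors. Moreover, this bound is tight up to the constant factor provided $K\le n/(\log n)^8$: there is an absolute constant $c>0$ such that for all sufficiently large $n$ and all $1\le K\le n/(\log n)^8$ there is a proper edge-coloring of $K_n$ with at most $Kn$ colors in which every spanning tree uses at least $cK\log(n/K)$ distinct colors.
   Context: A proper edge-coloring is one in which each color class is a matching.
   Formalization: The upper bound is stated for 0 < K ≤ n/2, since for K = n ≥ 2 the bound CK log(n/K) is 0 and fails; every proper edge-coloring of K_n has at most (n/2)n colors, so none is lost. K ranges over rationals, from which real K follows by approximation. -}

module Defs where

open import Data.Nat using (ℕ; zero; suc)
open import Data.Integer using (+_)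
open import Data.Rational using (ℚ; _/_; _+_; _*_; _≤_; 0ℚ; 1ℚ)
open import Data.Fin using (Fin)
open import Data.Fin.Subset using (Subset; _∈_; ∣_∣)
open import Data.List using (List; []; _∷_; _++_; [_]; length)
open import Data.List.Relation.Unary.Unique.Propositional using (Unique)
open import Data.Bool using (Bool; true)
open import Data.Product using (Σ; _×_; ∃)
open import Relation.Binary.PropositionalEquality using (_≡_; _≢_)
open import Relation.Nullary using (¬_)

ℕtoℚ : ℕ → ℚ
ℕtoℚ n = + n / 1

_^ℚ_ : ℚ → ℕ → ℚ
r ^ℚ zero  = 1ℚ
r ^ℚ suc k = (r ^ℚ k) * r

expTerm : ℚ → ℕ → ℚ
expTerm r zero    = 1ℚ
expTerm r (suc k) = expTerm r k * r * (+ 1 / suc k)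

expPartial : ℚ → ℕ → ℚ
expPartial r zero    = 0ℚ
expPartial r (suc N) = expPartial r N + expTerm r N

-- ExpLE r num den  means  exp(r) ≤ num / den   (intended for r ≥ 0, den > 0):
-- all partial sums of the exponential series are ≤ num/den.
ExpLE : ℚ → ℚ → ℚ → Set
ExpLE r num den = ∀ N → den * expPartial r N ≤ num

-- LeMulLn a b num den  means  a ≤ b · ln(num/den)   (for a ≥ 0, b > 0, den > 0)
LeMulLn : ℚ → ℚ → ℚ → ℚ → Set
LeMulLn a b num den = ∀ r → 0ℚ ≤ r → r * b ≤ a → ExpLE r num den

-- MulLnLe b num den a  means  b · ln(num/den) ≤ a   (for a ≥ 0, b > 0, den > 0)
MulLnLe : ℚ → ℚ → ℚ → ℚ → Set
MulLnLe b num den a = ∀ r → 0ℚ ≤ r → ExpLE r num den → r * b ≤ a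

-- LnPow8Le x num den  means  (ln x)^8 ≤ num / den   (for x ≥ 1, den > 0)
LnPow8Le : ℚ → ℚ → ℚ → Set
LnPow8Le x num den = ∀ r → 0ℚ ≤ r → ExpLE r x 1ℚ → den * (r ^ℚ 8) ≤ num

Symmetric : ∀ {n M} → (Fin n → Fin n → Fin M) → Set
Symmetric {n} col = ∀ (i j : Fin n) → col i j ≡ col j i

Proper : ∀ {n M} → (Fin n → Fin n → Fin M) → Set
Proper {n} col = ∀ (i j k : Fin n) → i ≢ j → i ≢ k → j ≢ k → col i j ≢ col i k

Adj : ∀ {n} → (Fin n → Fin n → Bool) → Fin n → Fin n → Set
Adj T u v = T u v ≡ true

data Walk {n} (T : Fin n → Fin n → Bool) : Fin n → Fin n → Set where
  here : ∀ {u} → Walk T u u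
  step : ∀ {u v w} → Adj T u v → Walk T v w → Walk T u w

data Chain {n} (T : Fin n → Fin n → Bool) : List (Fin n) → Set where
  one  : ∀ v → Chain T [ v ]
  cons : ∀ {u v vs} → Adj T u v → Chain T (v ∷ vs) → Chain T (u ∷ v ∷ vs)

HasCycle : ∀ {n} → (Fin n → Fin n → Bool) → Set
HasCycle {n} T =
  Σ (Fin n) λ u → Σ (List (Fin n)) λ rest → Σ (Fin n) λ w →
    (1 Data.Nat.≤ length rest) × Unique (u ∷ rest ++ [ w ]) ×
    Chain T (u ∷ rest ++ [ w ]) × Adj T w u

IsSpanningTree : ∀ {n} → (Fin n → Fin n → Bool) → Set
IsSpanningTree {n} T =
  (∀ u v → Adj T u v → Adj T v u) ×
  (∀ u → ¬ Adj T u u) ×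
  (∀ u v → Walk T u v) ×
  ¬ HasCycle T

CoversColours : ∀ {n M} → (Fin n → Fin n → Fin M) → (Fin n → Fin n → Bool) → Subset M → Set
CoversColours {n} col T S = ∀ (i j : Fin n) → Adj T i j → col i j ∈ S

{-# OPTIONS --safe #-}
-- Upper bound.  Grow one tree from a vertex.  If the tree has ρ vertices, the ρ(n − ρ)
-- edges leaving it have at most Kn colours, and the edges of one colour reach distinct
-- new vertices, so some colour adds at least ρ(n − ρ)/(Kn) vertices as leaves.  Starting
-- from K vertices, O(K) colours double ρ while ρ ≤ n/2 and then halve n − ρ, until at
-- most K vertices are left; these are added one colour at a time.
--
-- Lower bound for K ≥ 6.  Take about K blocks.  Give each vertex a set of at most h out
-- of 3h ground elements to avoid, where h is of order log(n/K), and colour an edge by its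
-- pair of blocks, a ground element avoided by neither end, and an index making the
-- colouring proper.  If the colours of S at a block involve at most h ground elements,
-- then the vertex of this block avoiding them is isolated; so each block needs h + 1
-- colours of S, and each colour serves two blocks.
--
-- Lower bound for K < 6.  Colour with exactly n colours.  The vertices are those of
-- ℤ₃^e × A together with r extra ones, and edges between different fibres of ℤ₃^e are
-- coloured by the sum.  Inside the fibre of v, the edge colours (2v , _) lost to new
-- colours are handed to the edges joining the fibre to the extra vertices.  As v = −2v,
-- the vertices over the span of the ℤ₃^e-components of S, together with the extra ones,
-- are closed under S-coloured edges, so |S| ≥ e.  Choosing r freely reaches every n.
module Submission where

open import Defs

module Combinatorics where

  open import Data.Nat as ℕ using (ℕ; zero; suc; z≤n; s≤s; _+_; _*_; _∸_; _≤_; _<_; _^_)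
  open import Data.Nat.Properties
  open import Data.Nat.DivMod hiding (_mod_)
  open import Data.Nat.Solver using (module +-*-Solver)
  open import Data.Fin as Fin using (Fin; zero; suc; toℕ; fromℕ<; combine; remQuot; join; splitAt)
  open import Data.Fin.Patterns using (0F; 1F; 2F; 3F; 4F; 5F)
  open import Data.Fin.Properties as Fin using (any?; all?; toℕ-fromℕ<; toℕ-injective; toℕ<n)
  open import Data.Fin.Subset using (Subset; _∈_; _∉_; ∣_∣; _∪_; ⁅_⁆; ⊥)
  open import Data.Fin.Subset.Properties using (∣⁅x⁆∣≡1; ∣⊥∣≡0; p⊆p∪q; q⊆p∪q; x∈⁅x⁆; ∪-comm; drop-there)
  open import Data.Bool using (Bool; true; false; not; _∧_; _∨_; _xor_; if_then_else_)
  import Data.Bool.Properties as Bool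
  open import Data.Vec as Vec using (Vec; []; _∷_; zipWith)
  import Data.Vec.Properties as Vec
  open import Data.List as List using (List; []; _∷_; _++_; [_]; length)
  import Data.List.Properties as List
  open import Data.List.Membership.Propositional using () renaming (_∈_ to _∈ˡ_)
  open import Data.List.Membership.Propositional.Properties using (∈-map⁺)
  open import Data.List.Relation.Unary.All as All using (All; []; _∷_)
  import Data.List.Relation.Unary.All.Properties as All
  open import Data.List.Relation.Unary.AllPairs using (_∷_)
  open import Data.List.Relation.Unary.Any using () renaming (here to hereˡ; there to thereˡ)
  open import Data.List.Relation.Unary.Unique.Propositional using (Unique)
  open import Data.Product as Prod using (Σ; ∃; _×_; _,_; proj₁; proj₂)
  import Data.Product.Properties as Prod
  open import Data.Sum as Sum using (_⊎_; inj₁; inj₂; reduce)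
  import Data.Sum.Properties as Sum
  open import Function using (_∘_; id)
  open import Relation.Binary.Definitions using (DecidableEquality)
  open import Relation.Binary.PropositionalEquality hiding ([_])
  open import Relation.Nullary using (¬_; Dec; yes; no; contradiction; does; ⌊_⌋)
  open import Relation.Nullary.Decidable using (_×-dec_; _→-dec_; ¬?; dec-true; dec-false; from-yes)

  -- Finite sums and cardinalities

  ∑ : ∀ {n} → (Fin n → ℕ) → ℕ
  ∑ {zero}  f = 0
  ∑ {suc n} f = f zero + ∑ (f ∘ suc)

  ∑-cong : ∀ {n} {f g : Fin n → ℕ} → (∀ i → f i ≡ g i) → ∑ f ≡ ∑ g
  ∑-cong {zero}  f≗g = refl
  ∑-cong {suc n} f≗g = cong₂ _+_ (f≗g zero) (∑-cong (f≗g ∘ suc))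

  ∑-mono : ∀ {n} {f g : Fin n → ℕ} → (∀ i → f i ≤ g i) → ∑ f ≤ ∑ g
  ∑-mono {zero}  f≤g = z≤n
  ∑-mono {suc n} f≤g = +-mono-≤ (f≤g zero) (∑-mono (f≤g ∘ suc))

  ∑-const : ∀ n m → ∑ {n} (λ _ → m) ≡ n * m
  ∑-const zero    m = refl
  ∑-const (suc n) m = cong (m +_) (∑-const n m)

  ∑-+ : ∀ {n} (f g : Fin n → ℕ) → ∑ (λ i → f i + g i) ≡ ∑ f + ∑ g
  ∑-+ {zero}  f g = refl
  ∑-+ {suc n} f g rewrite ∑-+ (f ∘ suc) (g ∘ suc) =
    solve 4 (λ a b c d → (a :+ b) :+ (c :+ d) := (a :+ c) :+ (b :+ d)) refl
      (f zero) (g zero) (∑ (f ∘ suc)) (∑ (g ∘ suc))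
    where
    open +-*-Solver

  ∑-*ˡ : ∀ {n} m (f : Fin n → ℕ) → ∑ (λ i → m * f i) ≡ m * ∑ f
  ∑-*ˡ {zero}  m f = sym (*-zeroʳ m)
  ∑-*ˡ {suc n} m f rewrite ∑-*ˡ m (f ∘ suc) = sym (*-distribˡ-+ m (f zero) (∑ (f ∘ suc)))

  ∑-*ʳ : ∀ {n} m (f : Fin n → ℕ) → ∑ (λ i → f i * m) ≡ ∑ f * m
  ∑-*ʳ m f = trans (∑-cong (λ i → *-comm (f i) m)) (trans (∑-*ˡ m f) (*-comm m (∑ f)))

  ∑-zero : ∀ {n} {f : Fin n → ℕ} → (∀ i → f i ≡ 0) → ∑ f ≡ 0
  ∑-zero {n} f≡0 = trans (∑-cong f≡0) (trans (∑-const n 0) (*-zeroʳ n))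

  ∑-swap : ∀ {m n} (f : Fin m → Fin n → ℕ) → ∑ (λ i → ∑ (f i)) ≡ ∑ (λ j → ∑ (λ i → f i j))
  ∑-swap {zero} {n} f = sym (∑-zero {n} {λ _ → 0} (λ _ → refl))
  ∑-swap {suc m} f = trans (cong (∑ (f zero) +_) (∑-swap (f ∘ suc)))
                           (sym (∑-+ (f zero) (λ j → ∑ (λ i → f (suc i) j))))

  ∑-average : ∀ {n} (f : Fin n → ℕ) → Fin n → ∃ λ i → ∑ f ≤ n * f i
  ∑-average {suc zero}    f _ = zero , ≤-refl
  ∑-average {suc (suc n)} f _ with ∑-average (f ∘ suc) zero
  ... | i , ∑≤ with ≤-total (f zero) (f (suc i))
  ... | inj₁ f0≤ = suc i , +-mono-≤ f0≤ ∑≤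
  ... | inj₂ ≤f0 = zero , +-monoʳ-≤ (f zero) (≤-trans ∑≤ (*-monoʳ-≤ (suc n) ≤f0))

  ind : Bool → ℕ
  ind true  = 1
  ind false = 0

  card : ∀ {n} → (Fin n → Bool) → ℕ
  card P = ∑ (ind ∘ P)

  ind≤1 : ∀ b → ind b ≤ 1
  ind≤1 true  = ≤-refl
  ind≤1 false = z≤n

  ∑-single : ∀ {n} (j : Fin n) (f : Fin n → ℕ) → (∀ i → i ≢ j → f i ≡ 0) → ∑ f ≡ f j
  ∑-single zero    f f≡0 = trans (cong (f zero +_) (∑-zero (λ i → f≡0 (suc i) λ ()))) (+-identityʳ _)
  ∑-single (suc j) f f≡0 = trans (cong (_+ ∑ (f ∘ suc)) (f≡0 zero λ ()))
    (∑-single j (f ∘ suc) (λ i i≢j → f≡0 (suc i) (i≢j ∘ Fin.suc-injective)))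

  card≤n : ∀ {n} (P : Fin n → Bool) → card P ≤ n
  card≤n {n} P = ≤-trans (∑-mono (ind≤1 ∘ P)) (≤-reflexive (trans (∑-const n 1) (*-identityʳ n)))

  n≤card⇒all : ∀ {n} (P : Fin n → Bool) → n ≤ card P → ∀ i → P i ≡ true
  n≤card⇒all {suc n} P n≤ i with P zero in eq
  n≤card⇒all {suc n} P (s≤s n≤) zero    | true = eq
  n≤card⇒all {suc n} P (s≤s n≤) (suc i) | true = n≤card⇒all (P ∘ suc) n≤ i
  n≤card⇒all {suc n} P n≤ i | false = contradiction n≤ (<⇒≱ (s≤s (card≤n (P ∘ suc))))

  card+card-not : ∀ {n} (P : Fin n → Bool) → card P + card (not ∘ P) ≡ n
  card+card-not {n} P = trans (sym (∑-+ (ind ∘ P) (ind ∘ not ∘ P)))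
    (trans (∑-cong (λ i → ind+ind-not (P i))) (trans (∑-const n 1) (*-identityʳ n)))
    where
    ind+ind-not : ∀ b → ind b + ind (not b) ≡ 1
    ind+ind-not true  = refl
    ind+ind-not false = refl

  -- Trees given by parent pointers

  module ParentTree {n : ℕ} (root : Fin n) (par : Fin n → Fin n) (rk : Fin n → ℕ)
                    (rk-par : ∀ v → v ≢ root → rk (par v) < rk v) where

    Child : Fin n → Fin n → Set
    Child u v = v ≢ root × par v ≡ u

    child? : ∀ u v → Dec (Child u v)
    child? u v = ¬? (v Fin.≟ root) ×-dec (par v Fin.≟ u)

    edge : Fin n → Fin n → Bool
    edge u v = ⌊ child? u v ⌋ ∨ ⌊ child? v u ⌋

    edge⁻ : ∀ {u v} → Adj edge u v → Child u v ⊎ Child v u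
    edge⁻ {u} {v} e with child? u v | child? v u
    ... | yes c | _     = inj₁ c
    ... | no _  | yes c = inj₂ c
    ... | no _  | no _  = contradiction e λ ()

    child⇒edge : ∀ {u v} → Child u v → Adj edge u v
    child⇒edge {u} {v} c with child? u v
    ... | yes _ = refl
    ... | no ¬c = contradiction c ¬c

    edge-sym : ∀ u v → Adj edge u v → Adj edge v u
    edge-sym u v = trans (Bool.∨-comm ⌊ child? v u ⌋ _)

    child-rk : ∀ {u v} → Child u v → rk u < rk v
    child-rk (v≢r , refl) = rk-par _ v≢r

    edge-irrefl : ∀ u → ¬ Adj edge u u
    edge-irrefl u e with edge⁻ {u} {u} e
    ... | inj₁ c = <-irrefl refl (child-rk c)
    ... | inj₂ c = <-irrefl refl (child-rk c)

    walk-++ : ∀ {u v w} → Walk edge u v → Walk edge v w → Walk edge u w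
    walk-++ here       q = q
    walk-++ (step e p) q = step e (walk-++ p q)

    walk-sym : ∀ {u v} → Walk edge u v → Walk edge v u
    walk-sym here       = here
    walk-sym (step {u} {v} e p) = walk-++ (walk-sym p) (step (edge-sym u v e) here)

    to-root : ∀ b v → rk v < b → Walk edge v root
    to-root (suc b) v (s≤s rk≤b) with v Fin.≟ root
    ... | yes refl = here
    ... | no v≢r   = step (edge-sym (par v) v (child⇒edge (v≢r , refl)))
                          (to-root b (par v) (≤-trans (rk-par v v≢r) rk≤b))

    connected : ∀ u v → Walk edge u v
    connected u v = walk-++ (to-root _ u ≤-refl) (walk-sym (to-root _ v ≤-refl))

    -- A path without repetitions that starts downwards stays downwards, since the
    -- only way up leads back to the previous vertex.
    descends : ∀ {x y} rest w → Unique (x ∷ y ∷ rest ++ [ w ]) → Chain edge (y ∷ rest ++ [ w ]) →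
               Child x y → rk y < rk w
    descends [] w ((x≢y ∷ x≢w ∷ []) ∷ _) (cons e (one _)) c with edge⁻ e
    ... | inj₁ c′            = child-rk c′
    ... | inj₂ (_ , refl)    = contradiction (sym (proj₂ c)) x≢w
    descends (z ∷ zs) w ((x≢y ∷ x≢z ∷ _) ∷ uniq) (cons e ch) c with edge⁻ e
    ... | inj₁ c′            = <-trans (child-rk c′) (descends zs w uniq ch c′)
    ... | inj₂ (_ , refl)    = contradiction (sym (proj₂ c)) x≢z

    -- The mirror image of `descends`, read from the far end. The parent `f` of `w` is not on the
    -- path, so the last step must climb to `w`; a downward step before it would have to stay
    -- downward, by `descends`.
    ascends : ∀ {x f} rest w → Unique (x ∷ rest ++ [ w ]) → Chain edge (x ∷ rest ++ [ w ]) →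
              All (f ≢_) (x ∷ rest) → Child f w → rk w < rk x
    ascends [] w _ (cons e (one _)) (f≢x ∷ []) (_ , refl) with edge⁻ e
    ... | inj₁ (_ , pw≡x) = contradiction pw≡x f≢x
    ... | inj₂ c = child-rk c
    ascends (z ∷ zs) w uniq@(_ ∷ uniq′) (cons e ch) (_ ∷ f≢) cw
      with edge⁻ e | ascends zs w uniq′ ch f≢ cw
    ... | inj₁ c | w<z = contradiction w<z (<-asym (descends zs w uniq ch c))
    ... | inj₂ c | w<z = <-trans w<z (child-rk c)

    -- Each of the two cycle edges at `u` leads to a child or to the parent of `u`. If either
    -- neighbour is a child, following ranks around the cycle gives a contradiction; if neither is,
    -- both neighbours are the one parent of `u`.
    acyclic : ¬ HasCycle edge
    acyclic (u , v ∷ rest , w , _ , uniq@((u≢v ∷ u≢) ∷ uniq′) , cons e ch , back)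
      with edge⁻ e | edge⁻ back
    ... | inj₁ d | inj₂ c = <-asym (ascends rest w uniq′ ch (u≢v ∷ All.++⁻ˡ rest u≢) c)
        (descends rest w uniq ch d)
    ... | inj₂ d | inj₂ c = <-asym (child-rk c)
            (<-trans (ascends rest w uniq′ ch (u≢v ∷ All.++⁻ˡ rest u≢) c) (child-rk d))
    ... | inj₁ d | inj₁ c = <-asym (child-rk c) (<-trans (child-rk d) (descends rest w uniq ch d))
    ... | inj₂ (_ , pu≡v) | inj₁ (_ , pu≡w) = v≢w rest uniq′ (trans (sym pu≡v) pu≡w)
      where
      v≢w : ∀ xs → Unique (v ∷ xs ++ [ w ]) → v ≢ w
      v≢w xs (v≢ ∷ _) = All.head (All.++⁻ʳ xs v≢)

    spanningTree : IsSpanningTree edge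
    spanningTree = edge-sym , edge-irrefl , connected , acyclic

  -- Growing a tree by one colour at a time

  ∨-introˡ : ∀ {a b} → a ≡ true → a ∨ b ≡ true
  ∨-introˡ refl = refl

  ∣p∪q∣≤∣p∣+∣q∣ : ∀ {n} (p q : Subset n) → ∣ p ∪ q ∣ ≤ ∣ p ∣ + ∣ q ∣
  ∣p∪q∣≤∣p∣+∣q∣ []           []           = z≤n
  ∣p∪q∣≤∣p∣+∣q∣ (true  ∷ p) (true  ∷ q) = s≤s (≤-trans (∣p∪q∣≤∣p∣+∣q∣ p q) (+-monoʳ-≤ ∣ p ∣ (n≤1+n _)))
  ∣p∪q∣≤∣p∣+∣q∣ (true  ∷ p) (false ∷ q) = s≤s (∣p∪q∣≤∣p∣+∣q∣ p q)
  ∣p∪q∣≤∣p∣+∣q∣ (false ∷ p) (true  ∷ q) = ≤-trans (s≤s (∣p∪q∣≤∣p∣+∣q∣ p q))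
      (≤-reflexive (sym (+-suc ∣ p ∣ ∣ q ∣)))
  ∣p∪q∣≤∣p∣+∣q∣ (false ∷ p) (false ∷ q) = ∣p∪q∣≤∣p∣+∣q∣ p q

  module Grow {n M : ℕ} (col : Fin n → Fin n → Fin M) (col-sym : Symmetric col) (proper : Proper col)
              (root : Fin n) where

    -- The pointers are constrained on `R` only; outside it `par` and `rk` are arbitrary. The number
    -- `s` merely bounds the size of `S`, because a colour may be chosen more than once.
    record Tree (s ρ : ℕ) : Set where
      field
        R      : Fin n → Bool
        par    : Fin n → Fin n
        rk     : Fin n → ℕ
        S      : Subset M
        ∣S∣≤s  : ∣ S ∣ ≤ s
        card-R : card R ≡ ρ
        R-root : R root ≡ true
        R-par  : ∀ v → R v ≡ true → v ≢ root →
                 R (par v) ≡ true × rk (par v) < rk v × col v (par v) ∈ S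

    start : Tree 0 1
    start = record
      { R = λ v → does (v Fin.≟ root); par = id; rk = λ _ → 0; S = ⊥
      ; ∣S∣≤s = ≤-reflexive (∣⊥∣≡0 M)
      ; card-R = trans (∑-single root _ (λ v v≢ → cong ind (dec-false (v Fin.≟ root) v≢)))
                       (cong ind (dec-true (root Fin.≟ root) refl))
      ; R-root = dec-true (root Fin.≟ root) refl
      ; R-par = λ v v∈R v≢ → contradiction (trans (sym v∈R) (dec-false (v Fin.≟ root) v≢)) λ ()
      }

    finish : ∀ {s ρ} → Tree s ρ → n ≤ ρ →
             Σ (Fin n → Fin n → Bool) λ T → IsSpanningTree T ×
             Σ (Subset M) λ S → CoversColours col T S × ∣ S ∣ ≤ s
    finish t n≤ρ = edge , spanningTree , S , covers , ∣S∣≤s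
      where
      open Tree t
      all : ∀ v → R v ≡ true
      all = n≤card⇒all R (subst (n ≤_) (sym card-R) n≤ρ)
      open ParentTree root par rk (λ v v≢ → proj₁ (proj₂ (R-par v (all v) v≢)))
      covers : CoversColours col edge S
      covers i j e with edge⁻ {i} {j} e
      ... | inj₁ (j≢ , refl) = subst (_∈ S) (col-sym j (par j)) (proj₂ (proj₂ (R-par j (all j) j≢)))
      ... | inj₂ (i≢ , refl) = proj₂ (proj₂ (R-par i (all i) i≢))

    module Extend {s ρ} (t : Tree s ρ) where
      open Tree t

      Link : Fin M → Fin n → Fin n → Set
      Link c v u = R u ≡ true × col u v ≡ c

      link? : ∀ c v u → Dec (Link c v u)
      link? c v u = (R u Bool.≟ true) ×-dec (col u v Fin.≟ c)

      new : Fin M → Fin n → Bool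
      new c v = not (R v) ∧ does (any? (link? c v))

      ∑-unique : ∀ {m} {P : Fin m → Set} (P? : ∀ i → Dec (P i)) → (∀ {i j} → P i → P j → i ≡ j) →
                 ∑ (λ i → ind (does (P? i))) ≤ ind (does (any? P?))
      ∑-unique P? uniq with any? P?
      ... | no ¬p = ≤-reflexive (∑-zero (λ i → cong ind (dec-false (P? i) (λ p → ¬p (i , p)))))
      ... | yes (j , p) = ≤-trans (≤-reflexive (∑-single j _
                (λ i i≢j → cong ind (dec-false (P? i) (λ q → i≢j (uniq q p)))))) (ind≤1 (does (P? j)))

      -- By properness a vertex outside `R` has at most one edge of colour `c` into `R`, so counting
      -- these edges is counting the vertices they reach.
      new-≥ : ∀ c v → ∑ (λ u → ind (not (R v)) * ind (does (link? c v u))) ≤ ind (new c v)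
      new-≥ c v with R v in eq
      ... | true  = ≤-reflexive (∑-zero {n} {λ _ → 0} (λ _ → refl))
      ... | false = ≤-trans (≤-reflexive (∑-cong (λ u → *-identityˡ (ind (does (link? c v u))))))
                            (∑-unique (link? c v) uniq)
        where
        ∉R : ∀ {u} → R u ≡ true → v ≢ u
        ∉R u∈R refl = contradiction (trans (sym u∈R) eq) λ ()
        uniq : ∀ {u u′} → Link c v u → Link c v u′ → u ≡ u′
        uniq {u} {u′} (u∈R , cu) (u′∈R , cu′) with u Fin.≟ u′
        ... | yes u≡u′ = u≡u′
        ... | no u≢u′  = contradiction
          (trans (col-sym v u) (trans cu (trans (sym cu′) (col-sym u′ v))))
          (proper v u u′ (∉R u∈R) (∉R u′∈R) u≢u′)

      ∑-links : ∀ v u → ∑ (λ c → ind (does (link? c v u))) ≡ ind (R u)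
      ∑-links v u with R u
      ... | false = ∑-zero {M} {λ _ → 0} (λ _ → refl)
      ... | true  = trans (∑-single (col u v) _ (λ c c≢ → cong ind
          (dec-false (col u v Fin.≟ c) (c≢ ∘ sym))))
                          (cong ind (dec-true (col u v Fin.≟ col u v) refl))

      -- Each edge leaving `R` has exactly one colour. Exchanging the sums counts these edges colour
      -- by colour, and `new-≥` turns edges into new vertices.
      ∑-new : card (not ∘ R) * card R ≤ ∑ (λ c → card (new c))
      ∑-new = begin
        card (not ∘ R) * card R
          ≡⟨ ∑-*ʳ (card R) (ind ∘ not ∘ R) ⟨
        ∑ (λ v → ind (not (R v)) * card R)
          ≡⟨ ∑-cong (λ v → sym (∑-*ˡ (ind (not (R v))) (ind ∘ R))) ⟩
        ∑ (λ v → ∑ (λ u → ind (not (R v)) * ind (R u)))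
          ≡⟨ ∑-cong (λ v → ∑-cong (λ u → trans (cong (ind (not (R v)) *_) (sym (∑-links v u)))
               (sym (∑-*ˡ (ind (not (R v))) (λ c → ind (does (link? c v u))))))) ⟩
        ∑ (λ v → ∑ (λ u → ∑ (λ c → ind (not (R v)) * ind (does (link? c v u)))))
          ≡⟨ ∑-cong (λ v → ∑-swap (λ u c → ind (not (R v)) * ind (does (link? c v u)))) ⟩
        ∑ (λ v → ∑ (λ c → ∑ (λ u → ind (not (R v)) * ind (does (link? c v u)))))
          ≡⟨ ∑-swap (λ v c → ∑ (λ u → ind (not (R v)) * ind (does (link? c v u)))) ⟩
        ∑ (λ c → ∑ (λ v → ∑ (λ u → ind (not (R v)) * ind (does (link? c v u)))))
          ≤⟨ ∑-mono (λ c → ∑-mono (new-≥ c)) ⟩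
        ∑ (λ c → card (new c)) ∎
        where
        open ≤-Reasoning

      module Add (c : Fin M) where
        attach : ∀ v → Dec (∃ (Link c v)) → Fin n
        attach v (yes (u , _)) = u
        -- A default that no vertex of the enlarged tree receives.
        attach v (no _)        = v

        par′ : Fin n → Fin n
        par′ v = if R v then par v else attach v (any? (link? c v))

        rk′ : Fin n → ℕ
        rk′ v = if R v then rk v else suc (rk (attach v (any? (link? c v))))

        card-∨ : ∀ v → ind (R v ∨ new c v) ≡ ind (R v) + ind (new c v)
        card-∨ v with R v
        ... | true  = refl
        ... | false = refl

        rk-old : ∀ {v} → R v ≡ true → rk′ v ≡ rk v
        rk-old eq rewrite eq = refl

        ∈ˡ : ∀ {x} → x ∈ S → x ∈ S ∪ ⁅ c ⁆
        ∈ˡ = p⊆p∪q ⁅ c ⁆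

        R-par′ : ∀ v → (R v ∨ new c v) ≡ true → v ≢ root →
                 (R (par′ v) ∨ new c (par′ v)) ≡ true × rk′ (par′ v) < rk′ v × col v (par′ v) ∈ S ∪ ⁅ c ⁆
        R-par′ v v∈ v≢ with R v in eq
        R-par′ v v∈ v≢ | true with R-par v eq v≢
        ... | p∈ , rk< , ∈S = ∨-introˡ p∈ , subst (_< rk v) (sym (rk-old p∈)) rk< , ∈ˡ ∈S
        R-par′ v v∈ v≢ | false with any? (link? c v)
        ... | yes (u , u∈ , cu) = ∨-introˡ u∈ , subst (_< suc (rk u)) (sym (rk-old u∈)) ≤-refl ,
                q⊆p∪q S ⁅ c ⁆ (subst (_∈ ⁅ c ⁆) (trans (sym cu) (col-sym u v)) (x∈⁅x⁆ c))

        tree : Tree (s + 1) (ρ + card (new c))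
        tree = record
          { R = λ v → R v ∨ new c v; par = par′; rk = rk′; S = S ∪ ⁅ c ⁆
          ; ∣S∣≤s = ≤-trans (∣p∪q∣≤∣p∣+∣q∣ S ⁅ c ⁆) (+-mono-≤ ∣S∣≤s (≤-reflexive (∣⁅x⁆∣≡1 c)))
          ; card-R = trans (∑-cong card-∨) (trans (∑-+ (ind ∘ R) (ind ∘ new c))
              (cong (_+ card (new c)) card-R))
          ; R-root = ∨-introˡ R-root
          ; R-par = R-par′
          }

      extend : ∃ λ p → Tree (s + 1) (ρ + p) × (n ∸ ρ) * ρ ≤ M * p
      -- The loop colour `col root root` only certifies that there is a colour to average over.
      extend with ∑-average (λ c → card (new c)) (col root root)
      ... | c , ∑≤ = card (new c) , Add.tree c , (begin
        (n ∸ ρ) * ρ              ≡⟨ cong (λ r → (n ∸ r) * r) (sym card-R) ⟩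
        (n ∸ card R) * card R
          ≡⟨ cong (_* card R) (trans (cong (_∸ card R) (sym (card+card-not R))) (m+n∸m≡n (card R) _)) ⟩
        card (not ∘ R) * card R  ≤⟨ ∑-new ⟩
        ∑ (λ c → card (new c))   ≤⟨ ∑≤ ⟩
        M * card (new c)         ∎)
        where
        open ≤-Reasoning

    iterate : (Q : ℕ → ℕ → Set) → (∀ i ρ p → Q i ρ → (n ∸ ρ) * ρ ≤ M * p → Q (suc i) (ρ + p)) →
              ∀ {s ρ} → Tree s ρ → Q 0 ρ → ∀ i → ∃ λ ρ′ → Tree (s + i) ρ′ × Q i ρ′
    iterate Q next {s} t q zero    = _ , subst (λ s → Tree s _) (sym (+-identityʳ s)) t , q
    iterate Q next {s} t q (suc i) with iterate Q next t q i
    ... | ρ , t′ , q′ with Extend.extend t′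
    ... | p , t″ , bound = ρ + p , subst (λ s → Tree s (ρ + p))
        (trans (+-assoc s i 1) (cong (s +_) (+-comm i 1))) t″ ,
                           next i ρ p q′ bound

    -- Phases of growth: single steps, doubling, halving

    module Phases (k : ℕ) {{_ : ℕ.NonZero k}} (M≤kn : M ≤ k * n) (0<n : 0 < n) where
      private instance
        n≢0 : ℕ.NonZero n
        n≢0 = ℕ.>-nonZero 0<n

      -- Dividing the number of crossing edges by `M ≤ k * n`. It is applied with `x` the smaller
      -- side of the cut, the other side having at least `n / 2` vertices.
      gain : ∀ x ρ {p} → n * x ≤ 2 * ((n ∸ ρ) * ρ) → (n ∸ ρ) * ρ ≤ M * p → x ≤ 2 * (k * p)
      gain x ρ {p} nx≤ bound = *-cancelˡ-≤ n (begin
        n * x                 ≤⟨ nx≤ ⟩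
        2 * ((n ∸ ρ) * ρ)     ≤⟨ *-monoʳ-≤ 2 (≤-trans bound (*-monoˡ-≤ p M≤kn)) ⟩
        2 * (k * n * p)
          ≡⟨ solve 3 (λ k n p → con 2 :* (k :* n :* p) := n :* (con 2 :* (k :* p))) refl k n p ⟩
        n * (2 * (k * p))     ∎)
        where
        open ≤-Reasoning
        open +-*-Solver

      -- While both sides of the cut are nonempty there is a crossing edge, so the chosen colour
      -- adds at least one vertex.
      creep : ∀ {s ρ} → Tree s ρ → 0 < ρ → ∀ i → ∃ λ ρ′ → Tree (s + i) ρ′ × (n ≤ ρ′ ⊎ ρ + i ≤ ρ′)
      creep {ρ = ρ₀} t 0<ρ₀ = iterate Q next t (inj₂ (≤-reflexive (+-identityʳ ρ₀)))
        where
        Q : ℕ → ℕ → Set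
        Q i ρ = n ≤ ρ ⊎ ρ₀ + i ≤ ρ
        next : ∀ i ρ p → Q i ρ → (n ∸ ρ) * ρ ≤ M * p → Q (suc i) (ρ + p)
        next i ρ p q bound with n ℕ.≤? ρ | q
        ... | yes n≤ρ | _        = inj₁ (≤-trans n≤ρ (m≤m+n ρ p))
        ... | no n≰ρ  | inj₁ n≤ρ = contradiction n≤ρ n≰ρ
        ... | no n≰ρ  | inj₂ ≤ρ  = inj₂ (subst (_≤ ρ + p) (sym (+-suc ρ₀ i))
                (≤-trans (≤-reflexive (+-comm 1 (ρ₀ + i))) (+-mono-≤ ≤ρ (0<p p bound))))
          where
          0<ρ : 0 < ρ
          0<ρ = ≤-trans 0<ρ₀ (≤-trans (m≤m+n ρ₀ i) ≤ρ)
          0<p : ∀ p → (n ∸ ρ) * ρ ≤ M * p → 0 < p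
          0<p (suc p) _ = s≤s z≤n
          0<p zero    b = contradiction (≤-trans (*-mono-≤ (m<n⇒0<n∸m (≰⇒> n≰ρ)) 0<ρ) b)
                                        (λ 1≤ → contradiction (subst (1 ≤_) (*-zeroʳ M) 1≤) λ ())

      double : ∀ {s ρ} c → Tree s ρ → n ≤ 2 * ρ ⊎ c ≤ ρ →
               ∃ λ ρ′ → Tree (s + 2 * k) ρ′ × (n ≤ 2 * ρ′ ⊎ 2 * c ≤ ρ′)
      double {ρ = ρ₀} c t q with iterate Q next t (init q) (2 * k)
        where
        Q : ℕ → ℕ → Set
        -- The last inequality is `ρ ≥ c (1 + i / 2k)` without denominators; at `i = 2k` it says
        -- that `c` has doubled.
        Q i ρ = n ≤ 2 * ρ ⊎ (c ≤ ρ × 2 * k * c + i * c ≤ 2 * k * ρ)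
        init : n ≤ 2 * ρ₀ ⊎ c ≤ ρ₀ → Q 0 ρ₀
        init (inj₁ n≤) = inj₁ n≤
        init (inj₂ c≤) = inj₂ (c≤ , ≤-trans (≤-reflexive (+-identityʳ (2 * k * c))) (*-monoʳ-≤ (2 * k) c≤))
        next : ∀ i ρ p → Q i ρ → (n ∸ ρ) * ρ ≤ M * p → Q (suc i) (ρ + p)
        next i ρ p q bound with n ℕ.≤? 2 * ρ | q
        ... | yes n≤ | _ = inj₁ (≤-trans n≤ (*-monoʳ-≤ 2 (m≤m+n ρ p)))
        ... | no n≰  | inj₁ n≤ = contradiction n≤ n≰
        ... | no n≰  | inj₂ (c≤ρ , inv) = inj₂ (≤-trans c≤ρ (m≤m+n ρ p) , (begin
            2 * k * c + suc i * c
              ≡⟨ solve 3 (λ k c i → con 2 :* k :* c :+ (c :+ i :* c) := con 2 :* k :* c :+ i :* c :+ c)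
                  refl k c i ⟩
            2 * k * c + i * c + c       ≤⟨ +-mono-≤ inv (≤-trans c≤ρ (gain ρ ρ nρ≤ bound)) ⟩
            2 * k * ρ + 2 * (k * p)
              ≡⟨ solve 3 (λ k ρ p → con 2 :* k :* ρ :+ con 2 :* (k :* p) := con 2 :* k :* (ρ :+ p))
                  refl k ρ p ⟩
            2 * k * (ρ + p)             ∎))
          where
          open ≤-Reasoning
          open +-*-Solver
          2ρ≤n : 2 * ρ ≤ n
          2ρ≤n = <⇒≤ (≰⇒> n≰)
          n≤2[n∸ρ] : n ≤ 2 * (n ∸ ρ)
          n≤2[n∸ρ] = ≤-trans (≤-reflexive (sym (m+n∸n≡m n n)))
              (≤-trans (≤-reflexive (cong (_∸ n) (cong (n +_) (sym (+-identityʳ n)))))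
             (≤-trans (∸-monoʳ-≤ (2 * n) 2ρ≤n) (≤-reflexive (sym (*-distribˡ-∸ 2 n ρ)))))
          nρ≤ : n * ρ ≤ 2 * ((n ∸ ρ) * ρ)
          nρ≤ = ≤-trans (*-monoˡ-≤ ρ n≤2[n∸ρ]) (≤-reflexive (*-assoc 2 (n ∸ ρ) ρ))
      ... | ρ , t′ , inj₁ n≤ = ρ , t′ , inj₁ n≤
      ... | ρ , t′ , inj₂ (_ , inv) = ρ , t′ , inj₂ (*-cancelˡ-≤ (2 * k) {{m*n≢0 2 k}} (≤-trans (≤-reflexive
              (solve 2 (λ k c → con 2 :* k :* (con 2 :* c) := con 2 :* k :* c :+ con 2 :* k :* c)
                  refl k c)) inv))
        where
        open +-*-Solver

      halve : ∀ {s ρ} → Tree s ρ → n ≤ 2 * ρ →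
              ∃ λ ρ′ → Tree (s + 2 * k) ρ′ × n ≤ 2 * ρ′ × 2 * (n ∸ ρ′) ≤ n ∸ ρ
      halve {ρ = ρ₀} t n≤2ρ₀ with iterate Q next t (n≤2ρ₀ , inj₂ (≤-reflexive (+-identityʳ _))) (2 * k)
        where
        a₀ = n ∸ ρ₀
        Q : ℕ → ℕ → Set
        -- As long as more than half of the `a₀` missing vertices remain, a colour adds at least
        -- `a₀ / 4k` of them. The second alternative records `i` such gains, which at `i = 2k`
        -- amount to half of `a₀`.
        Q i ρ = n ≤ 2 * ρ × (2 * (n ∸ ρ) ≤ a₀ ⊎ 4 * k * (n ∸ ρ) + i * a₀ ≤ 4 * k * a₀)
        next : ∀ i ρ p → Q i ρ → (n ∸ ρ) * ρ ≤ M * p → Q (suc i) (ρ + p)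
        next i ρ p (n≤2ρ , q) bound = ≤-trans n≤2ρ (*-monoʳ-≤ 2 (m≤m+n ρ p)) , next′ q
          where
          open ≤-Reasoning
          open +-*-Solver
          a = n ∸ ρ
          a∸p≡ : n ∸ (ρ + p) ≡ a ∸ p
          a∸p≡ = sym (∸-+-assoc n ρ p)
          next′ : 2 * a ≤ a₀ ⊎ 4 * k * a + i * a₀ ≤ 4 * k * a₀ →
                  2 * (n ∸ (ρ + p)) ≤ a₀ ⊎ 4 * k * (n ∸ (ρ + p)) + suc i * a₀ ≤ 4 * k * a₀
          next′ q rewrite a∸p≡ with 2 * a ℕ.≤? a₀ | q | p ℕ.≤? a
          ... | yes 2a≤ | _        | _      = inj₁ (≤-trans (*-monoʳ-≤ 2 (m∸n≤m a p)) 2a≤)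
          -- The invariant does not record `p ≤ a`; beyond it, truncated subtraction leaves nothing
          -- missing.
          ... | no _    | _        | no p≰a = inj₁ (≤-trans
              (≤-reflexive (cong (2 *_) (m≤n⇒m∸n≡0 (<⇒≤ (≰⇒> p≰a))))) z≤n)
          ... | no 2a≰  | inj₁ 2a≤ | _      = contradiction 2a≤ 2a≰
          ... | no 2a≰  | inj₂ inv | yes p≤a = inj₂ (begin
            4 * k * (a ∸ p) + (a₀ + i * a₀)
              ≤⟨ +-monoʳ-≤ (4 * k * (a ∸ p)) (+-monoˡ-≤ (i * a₀) a₀≤4kp) ⟩
            4 * k * (a ∸ p) + (2 * (2 * (k * p)) + i * a₀)
              ≡⟨ solve 4 (λ k b p j → con 4 :* k :* b :+ (con 2 :* (con 2 :* (k :* p)) :+ j)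
                  := con 4 :* k :* (b :+ p) :+ j) refl k (a ∸ p) p (i * a₀) ⟩
            4 * k * (a ∸ p + p) + i * a₀                ≡⟨ cong (λ x → 4 * k * x + i * a₀) (m∸n+n≡m p≤a) ⟩
            4 * k * a + i * a₀                          ≤⟨ inv ⟩
            4 * k * a₀                                  ∎)
            where
            na≤ : n * a ≤ 2 * (a * ρ)
            na≤ = ≤-trans (*-monoˡ-≤ a n≤2ρ) (≤-reflexive
                (solve 2 (λ r a → con 2 :* r :* a := con 2 :* (a :* r)) refl ρ a))
            a₀≤4kp : a₀ ≤ 2 * (2 * (k * p))
            a₀≤4kp = ≤-trans (<⇒≤ (≰⇒> 2a≰)) (*-monoʳ-≤ 2 (gain a ρ na≤ bound))
      ... | ρ , t′ , n≤ , inj₁ 2a≤ = ρ , t′ , n≤ , 2a≤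
      ... | ρ , t′ , n≤ , inj₂ inv = ρ , t′ , n≤ , *-cancelˡ-≤ (2 * k) {{m*n≢0 2 k}}
          (+-cancelʳ-≤ (2 * k * (n ∸ ρ₀)) _ _ (≤-trans
              (≤-reflexive (solve 3 (λ k a b → con 2 :* k :* (con 2 :* a) :+ con 2 :* k :* b
                  := con 4 :* k :* a :+ con 2 :* k :* b) refl k (n ∸ ρ) (n ∸ ρ₀)))
              (≤-trans inv (≤-reflexive (solve 2 (λ k b → con 4 :* k :* b
                  := con 2 :* k :* b :+ con 2 :* k :* b) refl k (n ∸ ρ₀))))))
        where
        open +-*-Solver

      doubles : ∀ J {s ρ} → Tree s ρ → n ≤ 2 * ρ ⊎ k ≤ ρ →
                ∃ λ ρ′ → Tree (s + J * (2 * k)) ρ′ × (n ≤ 2 * ρ′ ⊎ 2 ℕ.^ J * k ≤ ρ′)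
      doubles zero    {s} {ρ} t q = ρ , subst (λ s → Tree s ρ) (sym (+-identityʳ s)) t ,
                                    subst (λ x → n ≤ 2 * ρ ⊎ x ≤ ρ) (sym (+-identityʳ k)) q
      doubles (suc J) {s} t q₀ with doubles J t q₀
      ... | ρ , t′ , q with double (2 ℕ.^ J * k) t′ q
      ... | ρ′ , t″ , q′ = ρ′ ,
        subst (λ s → Tree s ρ′) (trans (+-assoc s (J * (2 * k)) (2 * k))
            (cong (s +_) (+-comm (J * (2 * k)) (2 * k)))) t″ ,
        subst (λ x → n ≤ 2 * ρ′ ⊎ x ≤ ρ′) (sym (*-assoc 2 (2 ℕ.^ J) k)) q′

      halves : ∀ J {s ρ} → Tree s ρ → n ≤ 2 * ρ →
               ∃ λ ρ′ → Tree (s + J * (2 * k)) ρ′ × n ≤ 2 * ρ′ × 2 ℕ.^ J * (n ∸ ρ′) ≤ n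
      halves zero    {s} {ρ} t n≤ = _ , subst (λ s → Tree s _) (sym (+-identityʳ s)) t , n≤ ,
                                    ≤-trans (≤-reflexive (+-identityʳ (n ∸ ρ))) (m∸n≤m n ρ)
      halves (suc J) {s} t n≤ with halves J t n≤
      ... | ρ , t′ , n≤′ , inv with halve t′ n≤′
      ... | ρ′ , t″ , n≤″ , 2a≤ = ρ′ ,
        subst (λ s → Tree s ρ′) (trans (+-assoc s (J * (2 * k)) (2 * k))
            (cong (s +_) (+-comm (J * (2 * k)) (2 * k)))) t″ , n≤″ ,
        ≤-trans (≤-reflexive (solve 2 (λ q a → con 2 :* q :* a := q :* (con 2 :* a)) refl (2 ℕ.^ J)
            (n ∸ ρ′)))
                (≤-trans (*-monoʳ-≤ (2 ℕ.^ J) 2a≤) inv)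
        where
        open +-*-Solver

      -- The four summands pay for reaching `k` vertices, for `J` doublings up to half of `n`, for
      -- `J` halvings of the rest down to at most `n / 2 ^ J ≤ k` vertices, and for adding these
      -- singly.
      few-colours : ∀ J → n ≤ 2 ℕ.^ J * k →
                    Σ (Fin n → Fin n → Bool) λ T → IsSpanningTree T ×
                    Σ (Subset M) λ S → CoversColours col T S × ∣ S ∣ ≤ k + J * (2 * k) + J * (2 * k) + k
      few-colours J n≤ with creep start (s≤s z≤n) k
      ... | ρ₁ , t₁ , q₁ with doubles J t₁ (Sum.map (λ n≤ρ → ≤-trans n≤ρ (m≤m+n ρ₁ _)) <⇒≤ q₁)
      ... | ρ₂ , t₂ , q₂ with halves J t₂ (reduce
          (Sum.map₂ (λ ≤ρ → ≤-trans n≤ (≤-trans ≤ρ (m≤m+n ρ₂ _))) q₂))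
      ... | ρ₃ , t₃ , n≤2ρ₃ , a≤ with creep t₃ (0<ρ₃ ρ₃ n≤2ρ₃) k
        where
        0<ρ₃ : ∀ ρ → n ≤ 2 * ρ → 0 < ρ
        0<ρ₃ zero    n≤0 = ≤-trans 0<n n≤0
        0<ρ₃ (suc ρ) _   = s≤s z≤n
      ... | ρ₄ , t₄ , inj₁ n≤ρ₄ = finish t₄ n≤ρ₄
      ... | ρ₄ , t₄ , inj₂ ≤ρ₄  = finish t₄ (begin
        n                 ≤⟨ m≤n+m∸n n ρ₃ ⟩
        ρ₃ + (n ∸ ρ₃)     ≤⟨ +-monoʳ-≤ ρ₃ (*-cancelˡ-≤ (2 ℕ.^ J) {{m^n≢0 2 J}} (≤-trans a≤ n≤)) ⟩
        ρ₃ + k            ≤⟨ ≤ρ₄ ⟩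
        ρ₄                ∎)
        where
        open ≤-Reasoning

  -- Cyclic groups

  module Cyclic (l : ℕ) {{l≢0 : ℕ.NonZero l}} where

    mod : ℕ → Fin l
    mod m = fromℕ< (m%n<n m l)

    toℕ-mod : ∀ m → toℕ (mod m) ≡ m % l
    toℕ-mod m = toℕ-fromℕ< (m%n<n m l)

    mod-cong : ∀ {m n} → m % l ≡ n % l → mod m ≡ mod n
    mod-cong {m} {n} eq = toℕ-injective (trans (toℕ-mod m) (trans eq (sym (toℕ-mod n))))

    mod-toℕ : ∀ x → mod (toℕ x) ≡ x
    mod-toℕ x = toℕ-injective (trans (toℕ-mod (toℕ x)) (m<n⇒m%n≡m (toℕ<n x)))

    mod-+l : ∀ m k → mod (m + k * l) ≡ mod m
    mod-+l m k = mod-cong ([m+kn]%n≡m%n m k l)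

    mod-+ʳ : ∀ m n → mod (m + toℕ (mod n)) ≡ mod (m + n)
    mod-+ʳ m n = mod-cong (begin
      (m + toℕ (mod n)) % l            ≡⟨ cong (λ x → (m + x) % l) (toℕ-mod n) ⟩
      (m + n % l) % l                  ≡⟨ %-distribˡ-+ m (n % l) l ⟩
      (m % l + n % l % l) % l          ≡⟨ cong (λ x → (m % l + x) % l) (m%n%n≡m%n n l) ⟩
      (m % l + n % l) % l              ≡⟨ %-distribˡ-+ m n l ⟨
      (m + n) % l                      ∎)
      where
      open ≡-Reasoning

    mod-*ʳ : ∀ m n → mod (m * toℕ (mod n)) ≡ mod (m * n)
    mod-*ʳ m n = mod-cong (begin
      (m * toℕ (mod n)) % l            ≡⟨ cong (λ x → (m * x) % l) (toℕ-mod n) ⟩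
      (m * (n % l)) % l                ≡⟨ %-distribˡ-* m (n % l) l ⟩
      (m % l * (n % l % l)) % l        ≡⟨ cong (λ x → (m % l * x) % l) (m%n%n≡m%n n l) ⟩
      (m % l * (n % l)) % l            ≡⟨ %-distribˡ-* m n l ⟨
      (m * n) % l                      ∎)
      where
      open ≡-Reasoning

    infixl 6 _⊕_
    _⊕_ : Fin l → Fin l → Fin l
    x ⊕ y = mod (toℕ x + toℕ y)

    neg : Fin l → Fin l
    neg x = mod (l ∸ toℕ x)

    ⊕-comm : ∀ x y → x ⊕ y ≡ y ⊕ x
    ⊕-comm x y = cong mod (+-comm (toℕ x) (toℕ y))

    ⊕-cancel-neg : ∀ x y → x ⊕ y ⊕ neg y ≡ x
    ⊕-cancel-neg x y = begin
      mod (toℕ (mod (toℕ x + toℕ y)) + toℕ (neg y))  ≡⟨ mod-+ʳ (toℕ (x ⊕ y)) (l ∸ toℕ y) ⟩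
      mod (toℕ (mod (toℕ x + toℕ y)) + (l ∸ toℕ y))  ≡⟨ cong mod (+-comm _ (l ∸ toℕ y)) ⟩
      mod (l ∸ toℕ y + toℕ (mod (toℕ x + toℕ y)))    ≡⟨ mod-+ʳ (l ∸ toℕ y) (toℕ x + toℕ y) ⟩
      mod (l ∸ toℕ y + (toℕ x + toℕ y))
        ≡⟨ cong mod (solve 3 (λ a x y → a :+ (x :+ y) := x :+ (a :+ y)) refl (l ∸ toℕ y) (toℕ x) (toℕ y)) ⟩
      mod (toℕ x + (l ∸ toℕ y + toℕ y))
        ≡⟨ cong (λ z → mod (toℕ x + z)) (trans (m∸n+n≡m (<⇒≤ (toℕ<n y))) (sym (*-identityˡ l))) ⟩
      mod (toℕ x + 1 * l)                            ≡⟨ mod-+l (toℕ x) 1 ⟩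
      mod (toℕ x)                                    ≡⟨ mod-toℕ x ⟩
      x ∎
      where
      open ≡-Reasoning
      open +-*-Solver

    ⊕-cancelʳ : ∀ z {x y} → x ⊕ z ≡ y ⊕ z → x ≡ y
    ⊕-cancelʳ z {x} {y} eq = trans (sym (⊕-cancel-neg x z)) (trans (cong (_⊕ neg z) eq) (⊕-cancel-neg y z))

    ⊕-cancelˡ : ∀ z {x y} → z ⊕ x ≡ z ⊕ y → x ≡ y
    ⊕-cancelˡ z {x} {y} eq = ⊕-cancelʳ z (trans (⊕-comm x z) (trans eq (⊕-comm z y)))

    ⊕-neg-cancel : ∀ x y → x ⊕ neg y ⊕ y ≡ x
    ⊕-neg-cancel x y = ⊕-cancelʳ (neg y) (⊕-cancel-neg (x ⊕ neg y) y)

    ⊕-identityʳ : ∀ x → x ⊕ mod 0 ≡ x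
    ⊕-identityʳ x = trans (mod-+ʳ (toℕ x) 0) (trans (cong mod (+-identityʳ (toℕ x))) (mod-toℕ x))

    neg-injective : ∀ {x y} → neg x ≡ neg y → x ≡ y
    neg-injective {x} {y} eq = ⊕-cancelˡ x (⊕-cancelʳ (neg x)
      (trans (⊕-cancel-neg x x) (sym (trans (cong (x ⊕ y ⊕_) eq) (⊕-cancel-neg x y)))))

    neg≡0⇒≡0 : ∀ {x} → neg x ≡ mod 0 → x ≡ mod 0
    neg≡0⇒≡0 {x} eq = ⊕-cancelˡ x (⊕-cancelʳ (neg x) (trans (⊕-cancel-neg x x)
      (sym (trans (cong (_⊕ neg x) (⊕-identityʳ x)) (trans (cong (x ⊕_) eq) (⊕-identityʳ x))))))

    -- Multiplication by h halves when l = 2h − 1.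
    double-injective : ∀ h → 2 * h ≡ suc l → ∀ d {x y} → x ⊕ (x ⊕ d) ≡ y ⊕ (y ⊕ d) → x ≡ y
    double-injective h 2h≡ d {x} {y} eq =
      ⊕-cancelʳ (mod (h * toℕ d)) (trans (sym (halve x))
          (trans (cong (λ z → mod (h * toℕ z)) eq) (halve y)))
      where
      open ≡-Reasoning
      open +-*-Solver
      halve : ∀ x → mod (h * toℕ (x ⊕ (x ⊕ d))) ≡ x ⊕ mod (h * toℕ d)
      halve x = begin
        mod (h * toℕ (x ⊕ (x ⊕ d)))
          ≡⟨ cong (λ z → mod (h * toℕ z)) (mod-+ʳ (toℕ x) (toℕ x + toℕ d)) ⟩
        mod (h * toℕ (mod (toℕ x + (toℕ x + toℕ d)))) ≡⟨ mod-*ʳ h _ ⟩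
        mod (h * (toℕ x + (toℕ x + toℕ d)))
          ≡⟨ cong mod (solve 3 (λ h x d → h :* (x :+ (x :+ d)) := con 2 :* h :* x :+ h :* d) refl h
              (toℕ x) (toℕ d)) ⟩
        mod (2 * h * toℕ x + h * toℕ d)        ≡⟨ cong (λ z → mod (z * toℕ x + h * toℕ d)) 2h≡ ⟩
        mod (suc l * toℕ x + h * toℕ d)
          ≡⟨ cong mod (solve 3 (λ l x e → (con 1 :+ l) :* x :+ e := x :+ e :+ x :* l) refl l (toℕ x)
              (h * toℕ d)) ⟩
        mod (toℕ x + h * toℕ d + toℕ x * l)    ≡⟨ mod-+l _ (toℕ x) ⟩
        mod (toℕ x + h * toℕ d)                ≡⟨ mod-+ʳ (toℕ x) (h * toℕ d) ⟨
        x ⊕ mod (h * toℕ d)                    ∎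

  -- Prolongation of a commutative quasigroup

  -- Each of the pairs (p , nbr i p) loses its colour p ⊞ nbr i p, which is given to
  -- the edge from p to one of r new vertices; the lost edges get new colours.
  module Prolong
    (P : Set) (_⊞_ : P → P → P)
    (⊞-comm : ∀ p q → p ⊞ q ≡ q ⊞ p) (⊞-cancelˡ : ∀ p {q q′} → p ⊞ q ≡ p ⊞ q′ → q ≡ q′)
    (I : Set) (nbr : I → P → P)
    (find : ∀ p q → Dec (∃ λ i → nbr i p ≡ q))
    (nbr-injective : ∀ p {i j} → nbr i p ≡ nbr j p → i ≡ j)
    (⊞-nbr-injective : ∀ i {p q} → p ⊞ nbr i p ≡ q ⊞ nbr i q → p ≡ q)
    (rev : I → I) (nbr-rev : ∀ i p → nbr i p ≢ p → nbr (rev i) (nbr i p) ≡ p)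
    (r : ℕ) {{_ : ℕ.NonZero r}} (fresh : I → P → Fin r)
    (fresh-rev : ∀ i p → nbr i p ≢ p → fresh (rev i) (nbr i p) ≡ fresh i p)
    (fresh-injective : ∀ p {i j} → nbr i p ≢ p → nbr j p ≢ p → fresh i p ≡ fresh j p → i ≡ j)
    (ι : Fin r → I) (ι-injective : ∀ {s t} → ι s ≡ ι t → s ≡ t)
    where

    open Cyclic r

    -- The decision is an argument so that later proofs can split on it.
    colour′ : ∀ p q → Dec (∃ λ i → nbr i p ≡ q) → P ⊎ Fin r
    colour′ p q (yes (i , _)) = inj₂ (fresh i p)
    colour′ p q (no _)        = inj₁ (p ⊞ q)

    -- If `nbr i p` is `p` itself, the colour handed over is `p ⊞ p`, which by cancellation no edge
    -- from `p` to another old vertex carries. Edges between new vertices can reuse the fresh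
    -- colours, since those occur elsewhere only between old vertices.
    colour : P ⊎ Fin r → P ⊎ Fin r → P ⊎ Fin r
    colour (inj₁ p) (inj₁ q) = colour′ p q (find p q)
    colour (inj₁ p) (inj₂ t) = inj₁ (p ⊞ nbr (ι t) p)
    colour (inj₂ t) (inj₁ p) = inj₁ (p ⊞ nbr (ι t) p)
    colour (inj₂ s) (inj₂ t) = inj₂ (s ⊕ t)

    colour-sym : ∀ x y → x ≢ y → colour x y ≡ colour y x
    colour-sym (inj₁ p) (inj₁ q) x≢y with find p q | find q p
    ... | no _            | no _ = cong inj₁ (⊞-comm p q)
    ... | yes (i , refl)  | no ∄ = contradiction (rev i , nbr-rev i p (λ eq → x≢y (cong inj₁ (sym eq)))) ∄
    ... | no ∄            | yes (i , refl) = contradiction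
        (rev i , nbr-rev i q (λ eq → x≢y (cong inj₁ eq))) ∄
    ... | yes (i , refl)  | yes (j , eq) = cong inj₂ (trans (sym (fresh-rev i p i≢))
            (cong (λ j → fresh j q) (nbr-injective q (trans (nbr-rev i p i≢) (sym eq)))))
      where
      i≢ : nbr i p ≢ p
      i≢ eq = x≢y (cong inj₁ (sym eq))
    colour-sym (inj₁ p) (inj₂ t) _ = refl
    colour-sym (inj₂ t) (inj₁ p) _ = refl
    colour-sym (inj₂ s) (inj₂ t) _ = cong inj₂ (⊕-comm s t)

    -- At an old vertex `p`, the edge to the new vertex `t` has the colour that `p` lost towards
    -- `nbr (ι t) p`, so no unchanged edge at `p` shares it. At a new vertex the map
    -- `p ↦ p ⊞ nbr i p` is injective.
    colour-proper : ∀ x y z → x ≢ y → x ≢ z → colour x y ≡ colour x z → y ≡ z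
    colour-proper (inj₁ p) (inj₁ q) (inj₁ q′) x≢y x≢z eq with find p q | find p q′
    ... | no _           | no _            = cong inj₁ (⊞-cancelˡ p (Sum.inj₁-injective eq))
    ... | yes (i , refl) | yes (j , refl)  = cong (λ i → inj₁ (nbr i p))
            (fresh-injective p (λ e → x≢y (cong inj₁ (sym e))) (λ e → x≢z (cong inj₁ (sym e)))
                (Sum.inj₂-injective eq))
    colour-proper (inj₁ p) (inj₁ q) (inj₂ t) _ _ eq with find p q
    ... | no ∄ = contradiction (ι t , sym (⊞-cancelˡ p (Sum.inj₁-injective eq))) ∄
    colour-proper (inj₁ p) (inj₂ t) (inj₁ q) _ _ eq with find p q
    ... | no ∄ = contradiction (ι t , ⊞-cancelˡ p (Sum.inj₁-injective eq)) ∄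
    colour-proper (inj₁ p) (inj₂ s) (inj₂ t) _ _ eq =
      cong inj₂ (ι-injective (nbr-injective p (⊞-cancelˡ p (Sum.inj₁-injective eq))))
    colour-proper (inj₂ t) (inj₁ p) (inj₁ q) _ _ eq = cong inj₁
        (⊞-nbr-injective (ι t) (Sum.inj₁-injective eq))
    colour-proper (inj₂ s) (inj₂ t) (inj₂ u) _ _ eq = cong inj₂ (⊕-cancelˡ s (Sum.inj₂-injective eq))

  -- A commutative quasigroup of order six

  Q : Set
  Q = Fin 6

  -- Found by computer search: v ∘ τ v = v for the 6-cycle τ, whose bipartition is χ,
  -- and the diagonal and the colours v ∘ μ v each occur twice and cover everything.
  infixl 7 _∘Q_
  _∘Q_ : Q → Q → Q
  v ∘Q w = Vec.lookup (Vec.lookup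
    ( (2F ∷ 0F ∷ 3F ∷ 4F ∷ 1F ∷ 5F ∷ [])
    ∷ (0F ∷ 4F ∷ 1F ∷ 5F ∷ 2F ∷ 3F ∷ [])
    ∷ (3F ∷ 1F ∷ 4F ∷ 2F ∷ 5F ∷ 0F ∷ [])
    ∷ (4F ∷ 5F ∷ 2F ∷ 0F ∷ 3F ∷ 1F ∷ [])
    ∷ (1F ∷ 2F ∷ 5F ∷ 3F ∷ 0F ∷ 4F ∷ [])
    ∷ (5F ∷ 3F ∷ 0F ∷ 1F ∷ 4F ∷ 2F ∷ []) ∷ []) v) w

  τ τ⁻¹ μ : Q → Q
  τ   = Vec.lookup (1F ∷ 2F ∷ 3F ∷ 4F ∷ 5F ∷ 0F ∷ [])
  τ⁻¹ = Vec.lookup (5F ∷ 0F ∷ 1F ∷ 2F ∷ 3F ∷ 4F ∷ [])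
  μ   = Vec.lookup (5F ∷ 2F ∷ 1F ∷ 4F ∷ 3F ∷ 0F ∷ [])

  χ : Q → Bool
  χ = Vec.lookup (false ∷ true ∷ false ∷ true ∷ false ∷ true ∷ [])

  -- The map `partner false b` fixes one class of `χ` and moves the other by `μ`: the loops supply
  -- half of the values of `v ∘Q partner false b v` and `μ` the other half. The maps
  -- `partner true b` go along the cycle `τ` in its two directions.
  partner : Bool → Bool → Q → Q
  partner false b v = if χ v xor b then v else μ v
  partner true  b v = if b then τ⁻¹ v else τ v

  ∘Q-comm : ∀ v w → v ∘Q w ≡ w ∘Q v
  ∘Q-comm = from-yes (all? λ v → all? λ w → v ∘Q w Fin.≟ w ∘Q v)

  ∘Q-cancelˡ : ∀ v w w′ → v ∘Q w ≡ v ∘Q w′ → w ≡ w′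
  ∘Q-cancelˡ = from-yes (all? λ v → all? λ w → all? λ w′ → (v ∘Q w Fin.≟ v ∘Q w′) →-dec (w Fin.≟ w′))

  -- Lets the finite checks below quantify over `Bool` and be decided by evaluation.
  bools? : {R : Bool → Set} → (∀ b → Dec (R b)) → Dec (∀ b → R b)
  bools? R? with R? true | R? false
  ... | yes t | yes f = yes λ { true → t ; false → f }
  ... | no ¬t | _     = no λ all → ¬t (all true)
  ... | _     | no ¬f = no λ all → ¬f (all false)

  ∘Q-partner-injective : ∀ c b v w → v ∘Q partner c b v ≡ w ∘Q partner c b w → v ≡ w
  ∘Q-partner-injective = from-yes (bools? λ c → bools? λ b → all? λ v → all? λ w →
    (v ∘Q partner c b v Fin.≟ w ∘Q partner c b w) →-dec (v Fin.≟ w))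

  partner-flip : ∀ c b v → partner c b v ≢ v → partner c (not b) (partner c b v) ≡ v
  partner-flip = from-yes (bools? λ c → bools? λ b → all? λ v →
    ¬? (partner c b v Fin.≟ v) →-dec (partner c (not b) (partner c b v) Fin.≟ v))

  partner-injective : ∀ c b b′ v → partner c b v ≡ partner c b′ v → b ≡ b′
  partner-injective = from-yes (bools? λ c → bools? λ b → bools? λ b′ → all? λ v →
    (partner c b v Fin.≟ partner c b′ v) →-dec (b Bool.≟ b′))

  χ-partner : ∀ c b v → partner c b v ≢ v → χ (partner c b v) ≡ not (χ v)
  χ-partner = from-yes (bools? λ c → bools? λ b → all? λ v →
    ¬? (partner c b v Fin.≟ v) →-dec (χ (partner c b v) Bool.≟ not (χ v)))

  partner-moves : ∀ b b′ v → partner false b v ≢ v → partner false b′ v ≢ v → b ≡ b′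
  partner-moves = from-yes (bools? λ b → bools? λ b′ → all? λ v →
    ¬? (partner false b v Fin.≟ v) →-dec (¬? (partner false b′ v Fin.≟ v) →-dec (b Bool.≟ b′)))

  partner-true-moves : ∀ b v → partner true b v ≢ v
  partner-true-moves = from-yes (bools? λ b → all? λ v → ¬? (partner true b v Fin.≟ v))

  bit : Bool → Fin 2
  bit false = zero
  bit true  = suc zero

  bit-injective : ∀ {b c} → bit b ≡ bit c → b ≡ c
  bit-injective {false} {false} _ = refl
  bit-injective {true}  {true}  _ = refl

  unbit : Fin 2 → Bool
  unbit zero    = false
  unbit (suc _) = true

  unbit-injective : ∀ {x y} → unbit x ≡ unbit y → x ≡ y
  unbit-injective {zero}     {zero}     _ = refl
  unbit-injective {suc zero} {suc zero} _ = refl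

  xor-cancelʳ : ∀ x {y z} → y xor x ≡ z xor x → y ≡ z
  xor-cancelʳ x {false} {false} _ = refl
  xor-cancelʳ x {true}  {true}  _ = refl
  xor-cancelʳ false {false} {true} ()
  xor-cancelʳ true  {false} {true} ()
  xor-cancelʳ false {true} {false} ()
  xor-cancelʳ true  {true} {false} ()

  not-xor-not : ∀ x y → not x xor not y ≡ x xor y
  not-xor-not false y = Bool.not-involutive y
  not-xor-not true  y = refl

  -- Elementary abelian 3-groups

  module Z₃ = Cyclic 3

  V : ℕ → Set
  V e = Vec (Fin 3) e

  infixl 6 _+ᵥ_
  _+ᵥ_ : ∀ {e} → V e → V e → V e
  _+ᵥ_ = zipWith Z₃._⊕_

  0ᵥ : ∀ {e} → V e
  0ᵥ = Vec.replicate _ zero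

  ⊕₃-assoc : ∀ x y z → (x Z₃.⊕ y) Z₃.⊕ z ≡ x Z₃.⊕ (y Z₃.⊕ z)
  ⊕₃-assoc = from-yes (all? λ x → all? λ y → all? λ z → (x Z₃.⊕ y) Z₃.⊕ z Fin.≟ x Z₃.⊕ (y Z₃.⊕ z))

  ⊕₃-triple : ∀ x y → x Z₃.⊕ (x Z₃.⊕ (x Z₃.⊕ y)) ≡ y
  ⊕₃-triple = from-yes (all? λ x → all? λ y → x Z₃.⊕ (x Z₃.⊕ (x Z₃.⊕ y)) Fin.≟ y)

  +ᵥ-comm : ∀ {e} (u v : V e) → u +ᵥ v ≡ v +ᵥ u
  +ᵥ-comm = Vec.zipWith-comm Z₃.⊕-comm

  +ᵥ-assoc : ∀ {e} (u v w : V e) → u +ᵥ v +ᵥ w ≡ u +ᵥ (v +ᵥ w)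
  +ᵥ-assoc = Vec.zipWith-assoc ⊕₃-assoc

  +ᵥ-identityˡ : ∀ {e} (u : V e) → 0ᵥ +ᵥ u ≡ u
  +ᵥ-identityˡ = Vec.zipWith-identityˡ λ x → trans (Z₃.⊕-comm zero x) (Z₃.⊕-identityʳ x)

  +ᵥ-triple : ∀ {e} (u v : V e) → u +ᵥ (u +ᵥ (u +ᵥ v)) ≡ v
  +ᵥ-triple []      []      = refl
  +ᵥ-triple (x ∷ u) (y ∷ v) = cong₂ _∷_ (⊕₃-triple x y) (+ᵥ-triple u v)

  +ᵥ-cancelˡ : ∀ {e} (u : V e) {v w} → u +ᵥ v ≡ u +ᵥ w → v ≡ w
  +ᵥ-cancelˡ u {v} {w} eq = trans (sym (+ᵥ-triple u v))
      (trans (cong (λ z → u +ᵥ (u +ᵥ z)) eq) (+ᵥ-triple u w))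

  -- In characteristic three `4u = u`, so doubling is its own inverse.
  +ᵥ-halve : ∀ {e} (u : V e) → (u +ᵥ u) +ᵥ (u +ᵥ u) ≡ u
  +ᵥ-halve u = trans (+ᵥ-assoc u u (u +ᵥ u)) (+ᵥ-triple u u)

  +ᵥ-double-injective : ∀ {e} {u v : V e} → u +ᵥ u ≡ v +ᵥ v → u ≡ v
  +ᵥ-double-injective {u = u} {v} eq = trans (sym (+ᵥ-halve u))
      (trans (cong (λ z → z +ᵥ z) eq) (+ᵥ-halve v))

  encode : ∀ {b e} → Vec (Fin b) e → Fin (b ^ e)
  encode []      = zero
  encode (x ∷ v) = combine x (encode v)

  decode : ∀ {b} e → Fin (b ^ e) → Vec (Fin b) e
  decode     zero    _ = []
  decode {b} (suc e) i = proj₁ (remQuot {b} (b ^ e) i) ∷ decode e (proj₂ (remQuot {b} (b ^ e) i))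

  encode-decode : ∀ {b} e i → encode (decode {b} e i) ≡ i
  encode-decode     zero    zero = refl
  encode-decode {b} (suc e) i = trans (cong (combine (proj₁ (remQuot {b} (b ^ e) i))) (encode-decode e _))
                                      (Fin.combine-remQuot {b} (b ^ e) i)

  decode-encode : ∀ {b e} (v : Vec (Fin b) e) → decode e (encode v) ≡ v
  decode-encode []      = refl
  decode-encode {b} {suc e} (x ∷ v) = cong₂ _∷_ (cong proj₁ rq)
      (trans (cong (decode e ∘ proj₂) rq) (decode-encode v))
    where rq = Fin.remQuot-combine {b} {b ^ e} x (encode v)

  -- Linear combinations over the field with three elements

  infixr 7 _·ᵥ_
  _·₃_ : Fin 3 → Fin 3 → Fin 3
  x ·₃ y = Z₃.mod (toℕ x * toℕ y)

  _·ᵥ_ : ∀ {e} → Fin 3 → V e → V e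
  x ·ᵥ v = Vec.map (x ·₃_) v

  ·₃-distribʳ : ∀ x y z → (x Z₃.⊕ y) ·₃ z ≡ (x ·₃ z) Z₃.⊕ (y ·₃ z)
  ·₃-distribʳ = from-yes (all? λ x → all? λ y → all? λ z → (x Z₃.⊕ y) ·₃ z Fin.≟ (x ·₃ z) Z₃.⊕ (y ·₃ z))

  ·ᵥ-distribʳ : ∀ {e} x y (v : V e) → (x Z₃.⊕ y) ·ᵥ v ≡ x ·ᵥ v +ᵥ y ·ᵥ v
  ·ᵥ-distribʳ x y []      = refl
  ·ᵥ-distribʳ x y (z ∷ v) = cong₂ _∷_ (·₃-distribʳ x y z) (·ᵥ-distribʳ x y v)

  ·ᵥ-identityˡ : ∀ {e} (v : V e) → suc zero ·ᵥ v ≡ v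
  ·ᵥ-identityˡ v = trans (Vec.map-cong (from-yes (all? λ z → suc zero ·₃ z Fin.≟ z)) v) (Vec.map-id v)

  ·ᵥ-zeroˡ : ∀ {e} (v : V e) → zero ·ᵥ v ≡ 0ᵥ
  ·ᵥ-zeroˡ v = trans (Vec.map-cong (λ z → refl) v) (Vec.map-const v zero)

  combination : ∀ {e} (cs : List (V e)) → V (length cs) → V e
  combination []       _        = 0ᵥ
  combination (c ∷ cs) (x ∷ xs) = x ·ᵥ c +ᵥ combination cs xs

  combination-+ : ∀ {e} (cs : List (V e)) xs ys → combination cs (xs +ᵥ ys)
      ≡ combination cs xs +ᵥ combination cs ys
  combination-+ []       []       []       = sym (+ᵥ-identityˡ 0ᵥ)
  combination-+ (c ∷ cs) (x ∷ xs) (y ∷ ys)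
    rewrite combination-+ cs xs ys | ·ᵥ-distribʳ x y c = begin
      (a +ᵥ b) +ᵥ (p +ᵥ q)  ≡⟨ +ᵥ-assoc a b (p +ᵥ q) ⟩
      a +ᵥ (b +ᵥ (p +ᵥ q))
        ≡⟨ cong (a +ᵥ_) (trans (sym (+ᵥ-assoc b p q))
            (trans (cong (_+ᵥ q) (+ᵥ-comm b p)) (+ᵥ-assoc p b q))) ⟩
      a +ᵥ (p +ᵥ (b +ᵥ q))  ≡⟨ +ᵥ-assoc a p (b +ᵥ q) ⟨
      (a +ᵥ p) +ᵥ (b +ᵥ q)  ∎
    where
    open ≡-Reasoning
    a = x ·ᵥ c
    b = y ·ᵥ c
    p = combination cs xs
    q = combination cs ys

  InSpan : ∀ {e} → List (V e) → V e → Set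
  InSpan cs v = ∃ λ xs → combination cs xs ≡ v

  span-+ : ∀ {e} (cs : List (V e)) {u v} → InSpan cs u → InSpan cs v → InSpan cs (u +ᵥ v)
  span-+ cs (xs , refl) (ys , refl) = xs +ᵥ ys , combination-+ cs xs ys

  span-0 : ∀ {e} (cs : List (V e)) → InSpan cs 0ᵥ
  span-0 []       = [] , refl
  span-0 (c ∷ cs) with span-0 cs
  ... | xs , eq = zero ∷ xs , trans (cong₂ _+ᵥ_ (·ᵥ-zeroˡ c) eq) (+ᵥ-identityˡ 0ᵥ)

  span-∈ : ∀ {e} {cs : List (V e)} {c} → c ∈ˡ cs → InSpan cs c
  span-∈ {cs = c ∷ cs} (hereˡ refl) with span-0 cs
  ... | xs , eq = suc zero ∷ xs , trans (cong₂ _+ᵥ_ (·ᵥ-identityˡ c) eq)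
      (trans (+ᵥ-comm c 0ᵥ) (+ᵥ-identityˡ c))
  span-∈ {cs = c ∷ cs} (thereˡ c∈) with span-∈ c∈
  ... | xs , eq = zero ∷ xs , trans (cong₂ _+ᵥ_ (·ᵥ-zeroˡ c) eq) (+ᵥ-identityˡ _)

  -- Counting replaces linear algebra: choosing coefficients for each vector injects `3 ^ e` vectors
  -- into `3 ^ length cs` coefficient tuples.
  span-all⇒e≤ : ∀ {e} (cs : List (V e)) → (∀ v → InSpan cs v) → e ≤ length cs
  span-all⇒e≤ {e} cs all = ≮⇒≥ λ s<e → <⇒≱ (^-monoʳ-< 3 (s≤s (s≤s z≤n)) s<e)
      (Fin.injective⇒≤ {f = code} code-injective)
    where
    code : Fin (3 ^ e) → Fin (3 ^ length cs)
    code i = encode (proj₁ (all (decode e i)))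
    coeffs : ∀ i → decode (length cs) (code i) ≡ proj₁ (all (decode e i))
    coeffs i = decode-encode _
    code-injective : ∀ {i j} → code i ≡ code j → i ≡ j
    code-injective {i} {j} eq = trans (sym (encode-decode e i)) (trans (cong encode
      (trans (sym (proj₂ (all (decode e i)))) (trans
          (cong (combination cs) (trans (sym (coeffs i)) (trans (cong (decode _) eq) (coeffs j))))
        (proj₂ (all (decode e j)))))) (encode-decode e j))

  elements : ∀ {n} → Subset n → List (Fin n)
  elements []          = []
  elements (true  ∷ p) = zero ∷ List.map suc (elements p)
  elements (false ∷ p) = List.map suc (elements p)

  length-elements : ∀ {n} (p : Subset n) → length (elements p) ≡ ∣ p ∣
  length-elements []          = refl
  length-elements (true  ∷ p) = cong suc (trans (List.length-map suc (elements p)) (length-elements p))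
  length-elements (false ∷ p) = trans (List.length-map suc (elements p)) (length-elements p)

  ∈-elements : ∀ {n} {p : Subset n} {x} → x ∈ p → x ∈ˡ elements p
  ∈-elements Vec.here                       = hereˡ refl
  ∈-elements {p = true  ∷ p} (Vec.there x∈) = thereˡ (∈-map⁺ suc (∈-elements x∈))
  ∈-elements {p = false ∷ p} (Vec.there x∈) = ∈-map⁺ suc (∈-elements x∈)

  -- The coloured complete graph on V e × Q × ℤ/(2i+1) and r further vertices

  module Construction (e i ρ r : ℕ) {{r≢0 : ℕ.NonZero r}}
    (ρ<l : suc ρ ≤ suc (2 * i)) (ρ*2<r : suc (ρ * 2) ≤ r) (r≤ : r ≤ suc ρ * 2) where

    l : ℕ
    l = suc (2 * i)

    module Zₗ = Cyclic l
    open Zₗ using (_⊕_; neg; mod)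

    P : Set
    P = V e × Q × Fin l

    _⊞_ : P → P → P
    (u , v , x) ⊞ (u′ , v′ , x′) = u +ᵥ u′ , v ∘Q v′ , x ⊕ x′

    triple : ∀ {u u′ : V e} {v v′ : Q} {x x′ : Fin l} → u ≡ u′ → v ≡ v′ → x ≡ x′ → (u , v , x) ≡
        (u′ , v′ , x′)
    triple refl refl refl = refl

    -- Indices with `d = 0` pair off vertices without a shift; those with `d > 0` shift by plus or
    -- minus `d`. There are `2ρ + 2` indices for the new vertices, while the lost edges need
    -- `2ρ + 1` fresh colours; hence the two admissible values of `r`.
    I : Set
    I = Fin (suc ρ) × Bool

    moving : Fin (suc ρ) → Bool
    moving zero    = false
    moving (suc _) = true

    shift : I → Fin l
    shift (zero  , _)     = mod 0
    shift (suc d , false) = Fin.inject≤ (suc d) ρ<l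
    shift (suc d , true)  = neg (Fin.inject≤ (suc d) ρ<l)

    nbr : I → P → P
    nbr (d , b) (u , v , x) = u , partner (moving d) b v , x ⊕ shift (d , b)

    rev : I → I
    rev (d , b) = d , not b

    -- The indices with `d = 0` share one colour, as only one of them moves a given vertex. For
    -- `d > 0`, `rev` flips `b` and the partner flips `χ`, so `b xor χ v` agrees at both ends of an
    -- edge, yet tells the two directions at one vertex apart.
    fresh : I → P → Fin r
    fresh (zero  , _) _           = Fin.inject≤ {suc (ρ * 2)} zero ρ*2<r
    fresh (suc d , b) (_ , v , _) = Fin.inject≤ (suc (combine d (bit (b xor χ v)))) ρ*2<r

    ι : Fin r → I
    ι t = Prod.map₂ unbit (remQuot 2 (Fin.inject≤ t r≤))

    _≟P_ : DecidableEquality P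
    _≟P_ = Prod.≡-dec (Vec.≡-dec Fin._≟_) (Prod.≡-dec Fin._≟_ Fin._≟_)

    find : ∀ p q → Dec (∃ λ j → nbr j p ≡ q)
    find p q with any? (λ d → nbr (d , false) p ≟P q) | any? (λ d → nbr (d , true) p ≟P q)
    ... | yes (d , eq) | _            = yes ((d , false) , eq)
    ... | no _         | yes (d , eq) = yes ((d , true) , eq)
    ... | no ∄f        | no ∄t        = no λ { ((d , false) , eq) → ∄f (d , eq) ; ((d , true) , eq) → ∄t
        (d , eq) }

    shift-suc≢0 : ∀ d b → shift (suc d , b) ≢ mod 0
    shift-suc≢0 d true  eq = shift-suc≢0 d false (Zₗ.neg≡0⇒≡0 {Fin.inject≤ (suc d) ρ<l} eq)
    shift-suc≢0 d false eq = contradiction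
      (trans (sym (Fin.toℕ-inject≤ (suc d) ρ<l)) (trans (cong toℕ eq) (Zₗ.toℕ-mod 0))) λ ()

    shift-injective : ∀ {d d′} b → shift (suc d , b) ≡ shift (suc d′ , b) → suc d ≡ suc d′
    shift-injective false eq = Fin.inject≤-injective ρ<l ρ<l _ _ eq
    shift-injective true  eq = Fin.inject≤-injective ρ<l ρ<l _ _ (Zₗ.neg-injective eq)

    -- The shift separates `d = 0` from `d > 0`. The shifts `d` and `-d′` may agree modulo `l`, but
    -- then `τ` and `τ⁻¹` differ in the `Q` component.
    nbr-injective : ∀ p {j k} → nbr j p ≡ nbr k p → j ≡ k
    nbr-injective (u , v , x) {j} {k} eq = go j k (cong (proj₁ ∘ proj₂) eq)
        (Zₗ.⊕-cancelˡ x (cong (proj₂ ∘ proj₂) eq))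
      where
      go : ∀ j k → partner (moving (proj₁ j)) (proj₂ j) v ≡ partner (moving (proj₁ k)) (proj₂ k) v →
           shift j ≡ shift k → j ≡ k
      go (zero  , b) (zero   , b′) pe se = cong (zero ,_) (partner-injective false b b′ v pe)
      go (zero  , b) (suc d′ , b′) pe se = contradiction (sym se) (shift-suc≢0 d′ b′)
      go (suc d , b) (zero   , b′) pe se = contradiction se (shift-suc≢0 d b)
      go (suc d , b) (suc d′ , b′) pe se with partner-injective true b b′ v pe
      ... | refl = cong (_, b) (shift-injective b se)

    stays : ∀ {u : V e} {v v′ : Q} {x : Fin l} → v′ ≡ v → (u , v′ , x ⊕ mod 0) ≡ (u , v , x)
    stays v≡ = triple refl v≡ (Zₗ.⊕-identityʳ _)

    nbr-rev : ∀ j p → nbr j p ≢ p → nbr (rev j) (nbr j p) ≡ p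
    nbr-rev (zero , b) (u , v , x) moved =
      triple refl (partner-flip false b v (moved ∘ stays)) (trans (Zₗ.⊕-identityʳ _) (Zₗ.⊕-identityʳ x))
    nbr-rev (suc d , false) (u , v , x) _ =
      triple refl (partner-flip true false v (partner-true-moves false v)) (Zₗ.⊕-cancel-neg x _)
    nbr-rev (suc d , true) (u , v , x) _ =
      triple refl (partner-flip true true v (partner-true-moves true v)) (Zₗ.⊕-neg-cancel x _)

    fresh-rev : ∀ j p → nbr j p ≢ p → fresh (rev j) (nbr j p) ≡ fresh j p
    fresh-rev (zero  , b) p           _ = refl
    fresh-rev (suc d , b) (_ , v , _) _ = cong (λ c → Fin.inject≤ (suc (combine d (bit c))) ρ*2<r)
      (trans (cong (not b xor_) (χ-partner true b v (partner-true-moves b v))) (not-xor-not b (χ v)))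

    fresh-injective : ∀ p {j k} → nbr j p ≢ p → nbr k p ≢ p → fresh j p ≡ fresh k p → j ≡ k
    fresh-injective (_ , v , _) {zero , b} {zero , b′} mj mk _ =
      cong (zero ,_) (partner-moves b b′ v (mj ∘ stays) (mk ∘ stays))
    fresh-injective _ {zero , _} {suc _ , _} _ _ eq = contradiction
        (Fin.inject≤-injective ρ*2<r ρ*2<r _ _ eq) λ ()
    fresh-injective _ {suc _ , _} {zero , _} _ _ eq = contradiction
        (Fin.inject≤-injective ρ*2<r ρ*2<r _ _ eq) λ ()
    fresh-injective (_ , v , _) {suc d , b} {suc d′ , b′} _ _ eq
      with Fin.combine-injective d _ d′ _ (Fin.suc-injective (Fin.inject≤-injective ρ*2<r ρ*2<r _ _ eq))
    ... | refl , be = cong (suc d ,_) (xor-cancelʳ (χ v) (bit-injective be))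

    ι-injective : ∀ {s t} → ι s ≡ ι t → s ≡ t
    ι-injective {s} {t} eq = Fin.inject≤-injective r≤ r≤ _ _
      (trans (sym (Fin.combine-remQuot 2 (Fin.inject≤ s r≤)))
      (trans (cong₂ combine (cong proj₁ eq) (unbit-injective (cong proj₂ eq)))
          (Fin.combine-remQuot 2 (Fin.inject≤ t r≤))))

    ⊞-nbr-injective : ∀ j {p q} → p ⊞ nbr j p ≡ q ⊞ nbr j q → p ≡ q
    ⊞-nbr-injective j@(d , b) {u , v , x} {u′ , v′ , x′} eq = triple
      (+ᵥ-double-injective (cong proj₁ eq))
      (∘Q-partner-injective (moving d) b v v′ (cong (proj₁ ∘ proj₂) eq))
      (Zₗ.double-injective (suc i) (solve 1 (λ i → con 2 :* (con 1 :+ i) := con 1 :+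
          (con 1 :+ con 2 :* i)) refl i)
         (shift j) (cong (proj₂ ∘ proj₂) eq))
      where
      open +-*-Solver

    ⊞-comm : ∀ p q → p ⊞ q ≡ q ⊞ p
    ⊞-comm (u , v , x) (u′ , v′ , x′) = triple (+ᵥ-comm u u′) (∘Q-comm v v′) (Zₗ.⊕-comm x x′)

    ⊞-cancelˡ : ∀ p {q q′} → p ⊞ q ≡ p ⊞ q′ → q ≡ q′
    ⊞-cancelˡ (u , v , x) eq = triple (+ᵥ-cancelˡ u (cong proj₁ eq))
      (∘Q-cancelˡ v _ _ (cong (proj₁ ∘ proj₂) eq)) (Zₗ.⊕-cancelˡ x (cong (proj₂ ∘ proj₂) eq))

    open Prolong P _⊞_ ⊞-comm ⊞-cancelˡ I nbr find nbr-injective ⊞-nbr-injective rev nbr-rev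
      r fresh fresh-rev fresh-injective ι ι-injective public

    n : ℕ
    n = 3 ^ e * (6 * l) + r

    enc : P ⊎ Fin r → Fin n
    enc = join (3 ^ e * (6 * l)) r ∘ Sum.map₁ (λ (u , v , x) → combine (encode u) (combine v x))

    decP : Fin (3 ^ e * (6 * l)) → P
    decP k = decode e (proj₁ (remQuot (6 * l) k)) , remQuot l (proj₂ (remQuot {3 ^ e} (6 * l) k))

    dec : Fin n → P ⊎ Fin r
    dec = Sum.map₁ decP ∘ splitAt (3 ^ e * (6 * l))

    dec-enc : ∀ x → dec (enc x) ≡ x
    dec-enc (inj₂ t) rewrite Fin.splitAt-join (3 ^ e * (6 * l)) r (inj₂ t) = refl
    dec-enc (inj₁ (u , v , x)) rewrite Fin.splitAt-join (3 ^ e * (6 * l)) r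
        (inj₁ (combine (encode u) (combine v x))) =
      cong inj₁ (cong₂ _,_ (trans (cong (decode e ∘ proj₁) rq) (decode-encode u))
          (trans (cong (remQuot l ∘ proj₂) rq) (Fin.remQuot-combine v x)))
      where rq = Fin.remQuot-combine {3 ^ e} {6 * l} (encode u) (combine v x)

    enc-dec : ∀ k → enc (dec k) ≡ k
    enc-dec k with splitAt (3 ^ e * (6 * l)) k in eq
    ... | inj₂ t = trans (cong (join _ r) (sym eq)) (Fin.join-splitAt _ r k)
    ... | inj₁ j = trans (cong (join (3 ^ e * (6 * l)) r ∘ inj₁)
            (trans (cong₂ combine (encode-decode e _) (Fin.combine-remQuot {6} l _))
                (Fin.combine-remQuot {3 ^ e} (6 * l) j)))
            (trans (cong (join _ r) (sym eq)) (Fin.join-splitAt _ r k))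

    col : Fin n → Fin n → Fin n
    col x y = enc (colour (dec x) (dec y))

    dec-injective : ∀ {x y} → dec x ≡ dec y → x ≡ y
    dec-injective {x} {y} eq = trans (sym (enc-dec x)) (trans (cong enc eq) (enc-dec y))

    col-sym : Symmetric col
    col-sym x y = by-cases (x Fin.≟ y)
      where
      by-cases : Dec (x ≡ y) → col x y ≡ col y x
      by-cases (yes refl) = refl
      by-cases (no x≢y)   = cong enc (colour-sym (dec x) (dec y) (x≢y ∘ dec-injective))

    col-proper : Proper col
    col-proper x y z x≢y x≢z y≢z eq = y≢z (dec-injective (colour-proper (dec x) (dec y) (dec z)
      (x≢y ∘ dec-injective) (x≢z ∘ dec-injective)
      (trans (sym (dec-enc _)) (trans (cong dec eq) (dec-enc _)))))

    -- Components of the colours on a spanning tree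

    module LowerBound (T : Fin n → Fin n → Bool) (conn : ∀ x y → Walk T x y)
                      (S : Subset n) (covers : CoversColours col T S) where

      -- Fresh colours are sent to zero, which enlarges no span.
      proj : P ⊎ Fin r → V e
      proj (inj₁ (u , _)) = u
      proj (inj₂ _)       = 0ᵥ

      cs : List (V e)
      cs = List.map (proj ∘ dec) (elements S)

      Closed : P ⊎ Fin r → Set
      Closed (inj₁ (u , _)) = InSpan cs u
      Closed (inj₂ _)       = InSpan cs 0ᵥ

      used : ∀ c → enc c ∈ S → InSpan cs (proj c)
      used c c∈S = subst (InSpan cs) (cong proj (dec-enc c)) (span-∈ (∈-map⁺ (proj ∘ dec) (∈-elements c∈S)))

      -- A recoloured edge stays inside one fibre, since `nbr` keeps the first component. Any other
      -- edge has component `u + u′`, and `u′ = u + (u + (u + u′))`.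
      closed-step′ : ∀ p q d → enc (colour′ p q d) ∈ S → InSpan cs (proj₁ p) → InSpan cs (proj₁ q)
      closed-step′ p q (yes (_ , refl)) _ cx = cx
      closed-step′ p q (no _) ∈S cx = subst (InSpan cs) (+ᵥ-triple (proj₁ p) (proj₁ q))
        (span-+ cs cx (span-+ cs cx (used (inj₁ (p ⊞ q)) ∈S)))

      -- From a new vertex the colour towards `p` has component `2u`, because `nbr` preserves `u`,
      -- and `u = 2u + 2u`.
      closed-step : ∀ x y → enc (colour x y) ∈ S → Closed x → Closed y
      closed-step (inj₁ p) (inj₁ q) = closed-step′ p q (find p q)
      closed-step _ (inj₂ t) _ _ = span-0 cs
      closed-step (inj₂ t) (inj₁ p) ∈S _ = subst (InSpan cs) (+ᵥ-halve (proj₁ p)) (span-+ cs c∈ c∈)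
        where c∈ = used (inj₁ (p ⊞ nbr (ι t) p)) ∈S

      closed-walk : ∀ {x y} → Walk T x y → Closed (dec x) → Closed (dec y)
      closed-walk here       cx = cx
      closed-walk (step {x} {y} e w) cx = closed-walk w (closed-step (dec x) (dec y) (covers x y e) cx)

      spans : ∀ u → InSpan cs u
      spans u = subst Closed (dec-enc (point u)) (closed-walk (conn (enc (point 0ᵥ)) (enc (point u)))
                  (subst Closed (sym (dec-enc (point 0ᵥ))) (span-0 cs)))
        where
        point : V e → P ⊎ Fin r
        point u = inj₁ (u , zero , zero)

      e≤∣S∣ : e ≤ ∣ S ∣
      e≤∣S∣ = ≤-trans (span-all⇒e≤ cs spans) (≤-reflexive
          (trans (List.length-map (proj ∘ dec) (elements S)) (length-elements S)))

  Forces : ∀ {n M} → (Fin n → Fin n → Fin M) → ℕ → Set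
  Forces {n} {M} col s = (T : Fin n → Fin n → Bool) → IsSpanningTree T →
                         (S : Subset M) → CoversColours col T S → s ≤ ∣ S ∣

  -- Dividing `n - D - 1` by `2D` writes `n = D (2i + 1) + (t + 1)` with `t < 2D`. So `r = t + 1` is
  -- positive and `ρ = t / 2 < D`; the size of `n` gives `D ≤ 2i + 1`, which leaves room for `ρ`
  -- nonzero shifts modulo `l`.
  forcing-n-colours : ∀ e n → (let D = 3 ^ e * 6) → suc (D + D * D) ≤ n →
                      Σ (Fin n → Fin n → Fin n) λ col → Symmetric col × Proper col × Forces col e
  forcing-n-colours e n n≥ = subst
    (λ n → Σ (Fin n → Fin n → Fin n) λ col → Symmetric col × Proper col × Forces col e) n≡
    (col , col-sym , col-proper , λ T (_ , _ , conn , _) S covers → LowerBound.e≤∣S∣ T conn S covers)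
    where
    D = 3 ^ e * 6
    instance
      2D≢0 : ℕ.NonZero (D * 2)
      2D≢0 = m*n≢0 D 2 {{m*n≢0 (3 ^ e) 6 {{m^n≢0 3 e}}}}
    m = n ∸ suc D
    i = m / (D * 2)
    t = m % (D * 2)
    ρ = t / 2
    m≡ : m ≡ t + i * (D * 2)
    m≡ = m≡m%n+[m/n]*n m (D * 2)
    D*D≤m : D * D ≤ m
    D*D≤m = ≤-trans (≤-reflexive (sym (m+n∸m≡n (suc D) (D * D)))) (∸-monoˡ-≤ (suc D) n≥)
    D<2i+2 : D < 2 + 2 * i
    D<2i+2 = *-cancelˡ-< D _ _ (≤-trans (s≤s (≤-trans D*D≤m (≤-reflexive m≡)))
      (≤-trans (+-monoˡ-≤ (i * (D * 2)) (m%n<n m (D * 2)))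
      (≤-reflexive (solve 2 (λ D i → D :* con 2 :+ i :* (D :* con 2) := D :* (con 2 :+ con 2 :* i))
          refl D i))))
      where
      open +-*-Solver
    ρ<D : ρ < D
    ρ<D = *-cancelʳ-< 2 ρ D (≤-trans (s≤s (m/n*n≤m t 2)) (m%n<n m (D * 2)))
    t<[1+ρ]*2 : t < suc ρ * 2
    t<[1+ρ]*2 = ≤-trans (≤-reflexive (cong suc (m≡m%n+[m/n]*n t 2))) (+-monoˡ-≤ (ρ * 2) (m%n<n t 2))
    open Construction e i ρ (suc t) (≤-trans ρ<D (ℕ.s≤s⁻¹ D<2i+2)) (s≤s (m/n*n≤m t 2)) t<[1+ρ]*2
      using (col; col-sym; col-proper; module LowerBound)
    n≡ : 3 ^ e * (6 * suc (2 * i)) + suc t ≡ n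
    n≡ = begin
      3 ^ e * (6 * suc (2 * i)) + suc t
        ≡⟨ solve 3 (λ E i t → E :* (con 6 :* (con 1 :+ con 2 :* i)) :+ (con 1 :+ t)
                                               := con 1 :+ E :* con 6 :+
                                                   (t :+ i :* (E :* con 6 :* con 2))) refl (3 ^ e) i t ⟩
      suc D + (t + i * (D * 2))          ≡⟨ cong (suc D +_) (sym m≡) ⟩
      suc D + (n ∸ suc D)                ≡⟨ m+[n∸m]≡n (≤-trans (s≤s (m≤m+n D (D * D))) n≥) ⟩
      n                                  ∎
      where
      open ≡-Reasoning
      open +-*-Solver

  -- Choosing elements outside a subset

  pick : ∀ {m} (s : Subset m) {j} → j + ∣ s ∣ ≤ m → Fin j → Fin m
  pick []          {suc j} () _
  pick {suc m} (true ∷ s) {j} j≤ x     = suc (pick s (ℕ.s≤s⁻¹ (subst (_≤ suc m) (+-suc j ∣ s ∣) j≤)) x)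
  pick (false ∷ s) {suc j} j≤ zero    = zero
  pick (false ∷ s) {suc j} j≤ (suc x) = suc (pick s (ℕ.s≤s⁻¹ j≤) x)

  pick-injective : ∀ {m} (s : Subset m) {j} (j≤ : j + ∣ s ∣ ≤ m) {x y} → pick s j≤ x ≡ pick s j≤ y → x ≡ y
  pick-injective []          {suc j} ()
  pick-injective (true  ∷ s) {j}     j≤ eq = pick-injective s _ (Fin.suc-injective eq)
  pick-injective (false ∷ s) {suc j} j≤ {zero}  {zero}  eq = refl
  pick-injective (false ∷ s) {suc j} j≤ {suc x} {suc y} eq = cong suc
      (pick-injective s _ (Fin.suc-injective eq))

  pick-∉ : ∀ {m} (s : Subset m) {j} (j≤ : j + ∣ s ∣ ≤ m) x → pick s j≤ x ∉ s
  pick-∉ []          {suc j} ()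
  pick-∉ (true  ∷ s) {j}     j≤ x       ∈s = pick-∉ s _ x (drop-there ∈s)
  pick-∉ (false ∷ s) {suc j} j≤ zero    ()
  pick-∉ (false ∷ s) {suc j} j≤ (suc x) ∈s = pick-∉ s _ x (drop-there ∈s)

  pick-cong : ∀ {m} {s s′ : Subset m} {j} (j≤ : j + ∣ s ∣ ≤ m) (j≤′ : j + ∣ s′ ∣ ≤ m) {x y} →
              s ≡ s′ → x ≡ y → pick s j≤ x ≡ pick s′ j≤′ y
  pick-cong j≤ j≤′ {x} refl refl = cong (λ p → pick _ p x) (≤-irrelevant j≤ j≤′)

  -- Unordered pairs, represented by their sorted listing

  sort : ∀ {k} → Fin k → Fin k → Fin k × Fin k
  sort p q with toℕ p ℕ.≤? toℕ q
  ... | yes _ = p , q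
  ... | no _  = q , p

  sort-comm : ∀ {k} (p q : Fin k) → sort p q ≡ sort q p
  sort-comm p q with toℕ p ℕ.≤? toℕ q | toℕ q ℕ.≤? toℕ p
  ... | yes p≤q | yes q≤p = cong₂ _,_ (toℕ-injective (≤-antisym p≤q q≤p))
      (toℕ-injective (≤-antisym q≤p p≤q))
  ... | yes _   | no _    = refl
  ... | no _    | yes _   = refl
  ... | no p≰q  | no q≰p  = contradiction (≰⇒≥ p≰q) q≰p

  sort-∋ : ∀ {k} (p q : Fin k) → proj₁ (sort p q) ≡ p ⊎ proj₂ (sort p q) ≡ p
  sort-∋ p q with toℕ p ℕ.≤? toℕ q
  ... | yes _ = inj₁ refl
  ... | no _  = inj₂ refl

  sort-injectiveʳ : ∀ {k} (p q q′ : Fin k) → sort p q ≡ sort p q′ → q ≡ q′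
  sort-injectiveʳ p q q′ eq with toℕ p ℕ.≤? toℕ q | toℕ p ℕ.≤? toℕ q′
  ... | yes _ | yes _ = cong proj₂ eq
  ... | no _  | no _  = cong proj₁ eq
  ... | yes _ | no _  = trans (cong proj₂ eq) (cong proj₁ eq)
  ... | no _  | yes _ = trans (cong proj₁ eq) (cong proj₂ eq)

  -- Block colourings

  -- A vertex (a , p , x) lies in block p and sees only colours whose ground element is
  -- outside avoided a.  The offsets x only spread the choice of that element evenly, so
  -- that N colours per ground element and pair of blocks suffice.
  module Blocks (k h N n : ℕ) {{_ : ℕ.NonZero h}} {{_ : ℕ.NonZero k}} {{_ : ℕ.NonZero N}}
    (n≤ : n ≤ N * (k * h)) (≤n : 2 ^ (h + (h + h)) * (k * h) ≤ n) where

    m = h + (h + h)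

    instance
      kh≢0 : ℕ.NonZero (k * h)
      kh≢0 = m*n≢0 k h
      2^m≢0 : ℕ.NonZero (2 ^ m)
      2^m≢0 = m^n≢0 2 m

    module Zh = Cyclic h
    module ZN = Cyclic N
    module Z2^m = Cyclic (2 ^ m)

    2^m≤N : 2 ^ m ≤ N
    2^m≤N = *-cancelʳ-≤ (2 ^ m) N (k * h) (≤-trans ≤n n≤)

    -- Oversized sets are replaced by the empty set, so that every label yields an admissible set.
    small : Subset m → Subset m
    small s with ∣ s ∣ ℕ.≤? h
    ... | yes _ = s
    ... | no _  = ⊥

    small-id : ∀ {s} → ∣ s ∣ ≤ h → small s ≡ s
    small-id {s} ≤h with ∣ s ∣ ℕ.≤? h
    ... | yes _ = refl
    ... | no ≰h = contradiction ≤h ≰h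

    avoided : Fin N → Subset m
    avoided a = small (Vec.map unbit (decode m (Z2^m.mod (toℕ a))))

    ∣avoided∣≤h : ∀ a → ∣ avoided a ∣ ≤ h
    ∣avoided∣≤h a with ∣ Vec.map unbit (decode m (Z2^m.mod (toℕ a))) ∣ ℕ.≤? h
    ... | yes ≤h = ≤h
    ... | no _   = ≤-trans (≤-reflexive (∣⊥∣≡0 m)) z≤n

    avoider : Subset m → Fin N
    avoider s = Fin.inject≤ (encode (Vec.map bit s)) 2^m≤N

    avoided-avoider : ∀ s → ∣ s ∣ ≤ h → avoided (avoider s) ≡ s
    avoided-avoider s ≤h = trans (cong small
      (trans (cong (Vec.map unbit) (trans (cong (decode m)
          (trans (cong Z2^m.mod (Fin.toℕ-inject≤ _ 2^m≤N)) (Z2^m.mod-toℕ _)))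
                                          (decode-encode (Vec.map bit s))))
      (trans (sym (Vec.map-∘ unbit bit s)) (trans (Vec.map-cong (λ { true → refl ; false → refl }) s)
          (Vec.map-id s)))))
      (small-id ≤h)

    -- Two sets of size at most `h` leave `h` of the `3h` ground elements free, one for each value
    -- of `x ⊕ x′`.
    room : ∀ a a′ → h + ∣ avoided a ∪ avoided a′ ∣ ≤ m
    room a a′ = +-monoʳ-≤ h (≤-trans (∣p∪q∣≤∣p∣+∣q∣ (avoided a) (avoided a′))
        (+-mono-≤ (∣avoided∣≤h a) (∣avoided∣≤h a′)))

    Vertex Colour : Set
    Vertex = Fin N × Fin k × Fin h
    Colour = (Fin k × Fin k) × Fin m × Fin N

    select : Vertex → Vertex → Fin m
    select (a , _ , x) (a′ , _ , x′) = pick (avoided a ∪ avoided a′) (room a a′) (x Zh.⊕ x′)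

    colour : Vertex → Vertex → Colour
    colour u@(a , p , x) u′@(a′ , p′ , x′) = sort p p′ , select u u′ , a ZN.⊕ a′

    colour-comm : ∀ u u′ → colour u u′ ≡ colour u′ u
    colour-comm (a , p , x) (a′ , p′ , x′) = cong₂ _,_ (sort-comm p p′) (cong₂ _,_
      (pick-cong (room a a′) (room a′ a) (∪-comm (avoided a) (avoided a′)) (Zh.⊕-comm x x′))
          (ZN.⊕-comm a a′))

    -- The blocks determine `p′` and the sum determines `a′`; then both avoided sets are known, and
    -- the ground element determines `x′`.
    colour-injectiveʳ : ∀ u v w → colour u v ≡ colour u w → v ≡ w
    colour-injectiveʳ (a , p , x) (a′ , p′ , x′) (a″ , p″ , x″) eq
      with sort-injectiveʳ p p′ p″ (cong proj₁ eq) | ZN.⊕-cancelˡ a (cong (proj₂ ∘ proj₂) eq)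
    ... | refl | refl = cong (λ x → a′ , p′ , x)
          (Zh.⊕-cancelˡ x (pick-injective (avoided a ∪ avoided a′) (room a a′) (cong (proj₁ ∘ proj₂) eq)))

    M : ℕ
    M = k * k * (m * N)

    enc : Colour → Fin M
    enc ((p , q) , i , g) = combine (combine p q) (combine i g)

    dec : Fin M → Colour
    dec c = remQuot k (proj₁ (remQuot (m * N) c)) , remQuot N (proj₂ (remQuot {k * k} (m * N) c))

    dec-enc : ∀ c → dec (enc c) ≡ c
    dec-enc ((p , q) , i , g) = cong₂ _,_
      (trans (cong (remQuot k ∘ proj₁) rq) (Fin.remQuot-combine p q))
      (trans (cong (remQuot N ∘ proj₂) rq) (Fin.remQuot-combine i g))
      where rq = Fin.remQuot-combine {k * k} {m * N} (combine p q) (combine i g)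

    vertex : Fin n → Vertex
    vertex v = Prod.map₂ (remQuot h) (remQuot (k * h) (Fin.inject≤ v n≤))

    vertex-injective : ∀ {u v} → vertex u ≡ vertex v → u ≡ v
    vertex-injective {u} {v} eq = Fin.inject≤-injective n≤ n≤ u v
      (trans (sym (code u)) (trans (cong (λ (a , p , x) → combine a (combine p x)) eq) (code v)))
      where
      code : ∀ v → (λ (a , p , x) → combine a (combine p x)) (vertex v) ≡ Fin.inject≤ v n≤
      code v = trans (cong (combine (proj₁ (vertex v))) (Fin.combine-remQuot {k} h _))
          (Fin.combine-remQuot {N} (k * h) (Fin.inject≤ v n≤))

    col : Fin n → Fin n → Fin M
    col u v = enc (colour (vertex u) (vertex v))

    col-sym : Symmetric col
    col-sym u v = cong enc (colour-comm (vertex u) (vertex v))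

    col-proper : Proper col
    col-proper u v w _ _ v≢w eq = v≢w (vertex-injective (colour-injectiveʳ (vertex u) (vertex v) (vertex w)
      (trans (sym (dec-enc _)) (trans (cong dec eq) (dec-enc _)))))

    -- Only triples whose code is below `n` are vertices. The labels `avoider s` are below `2 ^ m`,
    -- so all codes built from them are below `2 ^ m * (k * h) ≤ n`.
    witness : ∀ s (p : Fin k) → ∃ λ v → vertex v ≡ (avoider s , p , Zh.mod 0)
    witness s p = v , trans (cong (Prod.map₂ (remQuot h) ∘ remQuot (k * h)) inject-v)
      (trans (cong (Prod.map₂ (remQuot h)) (Fin.remQuot-combine (avoider s) (combine p (Zh.mod 0))))
             (cong (avoider s ,_) (Fin.remQuot-combine p (Zh.mod 0))))
      where
      c = combine (avoider s) (combine p (Zh.mod 0))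
      c<n : toℕ c < n
      c<n = begin-strict
        toℕ c
          ≡⟨ Fin.toℕ-combine (avoider s) (combine p (Zh.mod 0)) ⟩
        k * h * toℕ (avoider s) + toℕ (combine p (Zh.mod 0))
          <⟨ +-monoʳ-< (k * h * toℕ (avoider s)) (toℕ<n (combine p (Zh.mod 0))) ⟩
        k * h * toℕ (avoider s) + k * h
          ≡⟨ trans (+-comm _ (k * h)) (sym (*-suc (k * h) (toℕ (avoider s)))) ⟩
        k * h * suc (toℕ (avoider s))
          ≤⟨ *-monoʳ-≤ (k * h) (subst (_< 2 ^ m) (sym (Fin.toℕ-inject≤ _ 2^m≤N))
              (toℕ<n (encode (Vec.map bit s)))) ⟩
        k * h * 2 ^ m                                 ≡⟨ *-comm (k * h) (2 ^ m) ⟩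
        2 ^ m * (k * h)                               ≤⟨ ≤n ⟩
        n                                             ∎
        where
        open ≤-Reasoning
      v : Fin n
      v = fromℕ< c<n
      inject-v : Fin.inject≤ v n≤ ≡ c
      inject-v = toℕ-injective (trans (Fin.toℕ-inject≤ v n≤) (toℕ-fromℕ< c<n))

    -- Counting the ground elements seen by each block

    hits : Fin k → Colour → ℕ
    hits p ((q , q′) , _) = ind (does (p Fin.≟ q)) + ind (does (p Fin.≟ q′))

    touched : Fin k → List Colour → Subset m
    touched p []                      = ⊥
    touched p (c@((q , q′) , i , _) ∷ cs) = (if does (p Fin.≟ q) ∨ does
        (p Fin.≟ q′) then ⁅ i ⁆ else ⊥) ∪ touched p cs

    ∑-δ : ∀ (q : Fin k) → ∑ (λ p → ind (does (p Fin.≟ q))) ≡ 1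
    ∑-δ q = trans (∑-single q _ (λ p p≢q → cong ind (dec-false (p Fin.≟ q) p≢q)))
        (cong ind (dec-true (q Fin.≟ q) refl))

    ∣touched∣≤ : ∀ p c cs → ∣ touched p (c ∷ cs) ∣ ≤ hits p c + ∣ touched p cs ∣
    ∣touched∣≤ p ((q , q′) , i , _) cs = ≤-trans
      (∣p∪q∣≤∣p∣+∣q∣ (if does (p Fin.≟ q) ∨ does (p Fin.≟ q′) then ⁅ i ⁆ else ⊥) (touched p cs))
      (+-monoˡ-≤ ∣ touched p cs ∣ (head (does (p Fin.≟ q)) (does (p Fin.≟ q′))))
      where
      head : ∀ b b′ → ∣ (if b ∨ b′ then ⁅ i ⁆ else ⊥) ∣ ≤ ind b + ind b′
      head true  _     = ≤-trans (≤-reflexive (∣⁅x⁆∣≡1 i)) (s≤s z≤n)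
      head false true  = ≤-reflexive (∣⁅x⁆∣≡1 i)
      head false false = ≤-reflexive (∣⊥∣≡0 m)

    ∑∣touched∣≤ : ∀ cs → ∑ (λ p → ∣ touched p cs ∣) ≤ 2 * length cs
    ∑∣touched∣≤ [] = ≤-reflexive (∑-zero {k} (λ _ → ∣⊥∣≡0 m))
    ∑∣touched∣≤ (c@((q , q′) , _) ∷ cs) = begin
      ∑ (λ p → ∣ touched p (c ∷ cs) ∣)            ≤⟨ ∑-mono (λ p → ∣touched∣≤ p c cs) ⟩
      ∑ (λ p → hits p c + ∣ touched p cs ∣)       ≡⟨ ∑-+ (λ p → hits p c) (λ p → ∣ touched p cs ∣) ⟩
      ∑ (λ p → hits p c) + ∑ (λ p → ∣ touched p cs ∣)
        -- The hits of a colour sum to exactly 2, since a colour within one block is counted twice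
        -- there.
        ≤⟨ +-mono-≤ (≤-reflexive (trans (∑-+ {k} _ _) (cong₂ _+_ (∑-δ q) (∑-δ q′)))) (∑∣touched∣≤ cs) ⟩
      2 + 2 * length cs                           ≡⟨ *-suc 2 (length cs) ⟨
      2 * suc (length cs)                         ∎
      where
      open ≤-Reasoning

    ∈-touched : ∀ p {q q′ i g} cs → ((q , q′) , i , g) ∈ˡ cs → q ≡ p ⊎ q′ ≡ p → i ∈ touched p cs
    ∈-touched p {q} {q′} {i} (_ ∷ cs) (hereˡ refl) q∋ = p⊆p∪q (touched p cs)
        (subst (λ b → i ∈ (if b then ⁅ i ⁆ else ⊥)) (sym (hit q∋)) (x∈⁅x⁆ i))
      where
      hit : q ≡ p ⊎ q′ ≡ p → does (p Fin.≟ q) ∨ does (p Fin.≟ q′) ≡ true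
      hit (inj₁ refl) rewrite dec-true (p Fin.≟ p) refl = refl
      hit (inj₂ refl) rewrite dec-true (p Fin.≟ p) refl = Bool.∨-zeroʳ _
    ∈-touched p (c ∷ cs) (thereˡ c∈) q∋ = q⊆p∪q _ (touched p cs) (∈-touched p cs c∈ q∋)

    neighbour : ∀ {T : Fin n → Fin n → Bool} → (∀ u v → Walk T u v) → 2 ≤ n → ∀ u → ∃ (Adj T u)
    neighbour {T} conn 2≤n u = first (conn u (proj₁ other)) (proj₂ other)
      where
      first : ∀ {u v} → Walk T u v → u ≢ v → ∃ (Adj T u)
      first here         u≢v = contradiction refl u≢v
      first (step adj _) _   = _ , adj
      other : ∃ (u ≢_)
      other with u Fin.≟ fromℕ< (≤-trans (s≤s z≤n) 2≤n)
      ... | no u≢0  = _ , u≢0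
      ... | yes u≡0 = fromℕ< 2≤n , λ u≡1 → contradiction
              (trans (sym (toℕ-fromℕ< (≤-trans (s≤s z≤n) 2≤n)))
                  (trans (cong toℕ (trans (sym u≡0) u≡1)) (toℕ-fromℕ< 2≤n))) λ ()

    2≤n : 2 ≤ n
    2≤n = ≤-trans (*-mono-≤ {2} {2 ^ m} {1} {k * h}
        (≤-trans (≤-reflexive (sym (^-identityʳ 2))) (^-monoʳ-≤ 2 (ℕ.>-nonZero⁻¹ m {{m≢0}})))
        (ℕ.>-nonZero⁻¹ (k * h))) ≤n
      where
      m≢0 : ℕ.NonZero m
      m≢0 = ℕ.>-nonZero (≤-trans (ℕ.>-nonZero⁻¹ h) (m≤m+n h (h + h)))

    forces : (T : Fin n → Fin n → Bool) → IsSpanningTree T → (S : Subset M) → CoversColours col T S →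
             k * suc h ≤ 2 * ∣ S ∣
    forces T (_ , _ , conn , _) S covers = begin
      k * suc h                      ≡⟨ ∑-const k (suc h) ⟨
      ∑ {k} (λ _ → suc h)            ≤⟨ ∑-mono touched>h ⟩
      ∑ (λ p → ∣ touched p cs ∣)     ≤⟨ ∑∣touched∣≤ cs ⟩
      2 * length cs
        ≡⟨ cong (2 *_) (trans (List.length-map dec (elements S)) (length-elements S)) ⟩
      2 * ∣ S ∣                      ∎
      where
      open ≤-Reasoning
      cs : List Colour
      cs = List.map dec (elements S)
      -- Otherwise the vertex of block p avoiding exactly the touched set would be isolated.
      touched>h : ∀ p → h < ∣ touched p cs ∣
      touched>h p = ≰⇒> λ ≤h → isolated ≤h
        where
        I = touched p cs
        v = proj₁ (witness I p)
        w = proj₁ (neighbour {T} conn 2≤n v)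
        c = colour (avoider I , p , Zh.mod 0) (vertex w)
        c∈cs : c ∈ˡ cs
        c∈cs = subst (_∈ˡ cs) (trans (dec-enc _) (cong (λ u → colour u (vertex w)) (proj₂ (witness I p))))
                 (∈-map⁺ dec (∈-elements (covers v w (proj₂ (neighbour {T} conn 2≤n v)))))
        isolated : ¬ (∣ I ∣ ≤ h)
        isolated ≤h = pick-∉ (avoided (avoider I) ∪ avoided (proj₁ (vertex w))) (room _ _) _
          (p⊆p∪q (avoided (proj₁ (vertex w))) (subst (proj₁ (proj₂ c) ∈_) (sym (avoided-avoider I ≤h))
            (∈-touched p cs c∈cs (sort-∋ p (proj₁ (proj₂ (vertex w)))))))

  forcing-many-colours : ∀ k h n → {{ℕ.NonZero k}} → {{ℕ.NonZero h}} → 2 ^ (h + (h + h)) * (k * h) ≤ n →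
    ∃ λ M → Σ (Fin n → Fin n → Fin M) λ col → M ≤ 6 * k * n × Symmetric col × Proper col ×
    ((T : Fin n → Fin n → Bool) → IsSpanningTree T → (S : Subset M) → CoversColours col T S → k * suc h
        ≤ 2 * ∣ S ∣)
  forcing-many-colours k h n ≤n = M , col , M≤ , col-sym , col-proper , forces
    where
    instance
      kh≢0′ : ℕ.NonZero (k * h)
      kh≢0′ = m*n≢0 k h
    d = n / (k * h)
    n≤ : n ≤ suc d * (k * h)
    n≤ = ≤-trans (≤-reflexive (m≡m%n+[m/n]*n n (k * h))) (+-monoˡ-≤ (d * (k * h)) (<⇒≤ (m%n<n n (k * h))))
    open Blocks k h (suc d) n n≤ ≤n using (M; col; col-sym; col-proper; forces)
    kh≤n : k * h ≤ n
    kh≤n = ≤-trans (m≤n*m (k * h) (2 ^ (h + (h + h))) {{m^n≢0 2 (h + (h + h))}}) ≤n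
    -- The ground set contributes a factor 3. Rounding `n / (k * h)` up at most doubles it, because
    -- `k * h ≤ n`.
    M≤ : M ≤ 6 * k * n
    M≤ = begin
      k * k * ((h + (h + h)) * suc d)
        ≡⟨ solve 3 (λ k h d → k :* k :* ((h :+ (h :+ h)) :* (con 1 :+ d)) := con 3 :* k :*
            (d :* (k :* h) :+ k :* h)) refl k h d ⟩
      3 * k * (d * (k * h) + k * h)   ≤⟨ *-monoʳ-≤ (3 * k) (+-mono-≤ (m/n*n≤m n (k * h)) kh≤n) ⟩
      3 * k * (n + n)
        ≡⟨ solve 2 (λ k n → con 3 :* k :* (n :+ n) := con 6 :* k :* n) refl k n ⟩
      6 * k * n                               ∎
      where
      open ≤-Reasoning
      open +-*-Solver

-- Estimates for the exponential series

open import Data.Nat using (ℕ; zero; suc; z≤n; s≤s)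
import Data.Nat as ℕ
import Data.Nat.Properties as ℕ
import Data.Nat.DivMod as ℕ
import Data.Nat.Solver as ℕ
open import Data.Integer as ℤ using (+_)
import Data.Integer.Properties as ℤ
open import Data.Rational using (ℚ; _/_; _+_; _*_; _≤_; _<_; 0ℚ; 1ℚ; ½; toℚᵘ; nonNegative; positive)
open import Data.Rational.Properties
import Data.Rational.Unnormalised as ℚᵘ
import Data.Rational.Unnormalised.Properties as ℚᵘ
open import Data.Rational.Solver using (module +-*-Solver)
open import Data.Fin as Fin using (Fin; zero; suc)
import Data.Fin.Properties as Fin
open import Data.Fin.Subset using (Subset; ∣_∣)
open import Data.Bool using (Bool)
open import Data.Product using (Σ; ∃; _×_; _,_; proj₁; proj₂)
open import Data.Sum using ([_,_]′)
open import Function using (_∘_; id)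
open import Relation.Binary.PropositionalEquality
open import Relation.Nullary using (¬_; Dec; yes; no; contradiction)

-- The naturals inside the rationals

toℚᵘ-ℕtoℚ : ∀ n → toℚᵘ (ℕtoℚ n) ℚᵘ.≃ ℚᵘ.mkℚᵘ (+ n) 0
toℚᵘ-ℕtoℚ n = toℚᵘ-fromℚᵘ (ℚᵘ.mkℚᵘ (+ n) 0)

ℕtoℚ-* : ∀ m n → ℕtoℚ (m ℕ.* n) ≡ ℕtoℚ m * ℕtoℚ n
ℕtoℚ-* m n = toℚᵘ-injective (begin
  toℚᵘ (ℕtoℚ (m ℕ.* n))                        ≈⟨ toℚᵘ-ℕtoℚ (m ℕ.* n) ⟩
  ℚᵘ.mkℚᵘ (+ (m ℕ.* n)) 0                      ≈⟨ ℚᵘ.*≡* (cong (ℤ._* (+ 1)) (ℤ.pos-* m n)) ⟩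
  ℚᵘ.mkℚᵘ (+ m) 0 ℚᵘ.* ℚᵘ.mkℚᵘ (+ n) 0         ≈⟨ ℚᵘ.*-cong (toℚᵘ-ℕtoℚ m) (toℚᵘ-ℕtoℚ n) ⟨
  toℚᵘ (ℕtoℚ m) ℚᵘ.* toℚᵘ (ℕtoℚ n)             ≈⟨ toℚᵘ-homo-* (ℕtoℚ m) (ℕtoℚ n) ⟨
  toℚᵘ (ℕtoℚ m * ℕtoℚ n)                       ∎)
  where
  open ℚᵘ.≃-Reasoning

ℕtoℚ-+ : ∀ m n → ℕtoℚ (m ℕ.+ n) ≡ ℕtoℚ m + ℕtoℚ n
ℕtoℚ-+ m n = toℚᵘ-injective (begin
  toℚᵘ (ℕtoℚ (m ℕ.+ n))                        ≈⟨ toℚᵘ-ℕtoℚ (m ℕ.+ n) ⟩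
  ℚᵘ.mkℚᵘ (+ (m ℕ.+ n)) 0                      ≈⟨ ℚᵘ.*≡* (cong (ℤ._* (+ 1)) (trans (ℤ.pos-+ m n)
                                                    (sym (cong₂ ℤ._+_ (ℤ.*-identityʳ (+ m))
                                                        (ℤ.*-identityʳ (+ n)))))) ⟩
  ℚᵘ.mkℚᵘ (+ m) 0 ℚᵘ.+ ℚᵘ.mkℚᵘ (+ n) 0         ≈⟨ ℚᵘ.+-cong (toℚᵘ-ℕtoℚ m) (toℚᵘ-ℕtoℚ n) ⟨
  toℚᵘ (ℕtoℚ m) ℚᵘ.+ toℚᵘ (ℕtoℚ n)             ≈⟨ toℚᵘ-homo-+ (ℕtoℚ m) (ℕtoℚ n) ⟨
  toℚᵘ (ℕtoℚ m + ℕtoℚ n)                       ∎)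
  where
  open ℚᵘ.≃-Reasoning

ℕtoℚ-mono : ∀ {m n} → m ℕ.≤ n → ℕtoℚ m ≤ ℕtoℚ n
ℕtoℚ-mono {m} {n} m≤n = toℚᵘ-cancel-≤ (begin
  toℚᵘ (ℕtoℚ m)      ≃⟨ toℚᵘ-ℕtoℚ m ⟩
  ℚᵘ.mkℚᵘ (+ m) 0    ≤⟨ ℚᵘ.*≤* (ℤ.*-monoʳ-≤-nonNeg (+ 1) (ℤ.+≤+ m≤n)) ⟩
  ℚᵘ.mkℚᵘ (+ n) 0    ≃⟨ toℚᵘ-ℕtoℚ n ⟨
  toℚᵘ (ℕtoℚ n)      ∎)
  where
  open ℚᵘ.≤-Reasoning

ℕtoℚ-cancel : ∀ {m n} → ℕtoℚ m ≤ ℕtoℚ n → m ℕ.≤ n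
ℕtoℚ-cancel {m} {n} m≤n = ℤ.drop‿+≤+ (subst₂ ℤ._≤_ (ℤ.*-identityʳ (+ m)) (ℤ.*-identityʳ (+ n))
    (ℚᵘ.drop-*≤* (begin
  ℚᵘ.mkℚᵘ (+ m) 0    ≃⟨ toℚᵘ-ℕtoℚ m ⟨
  toℚᵘ (ℕtoℚ m)      ≤⟨ toℚᵘ-mono-≤ m≤n ⟩
  toℚᵘ (ℕtoℚ n)      ≃⟨ toℚᵘ-ℕtoℚ n ⟩
  ℚᵘ.mkℚᵘ (+ n) 0    ∎)))
  where
  open ℚᵘ.≤-Reasoning

0≤ℕtoℚ : ∀ n → 0ℚ ≤ ℕtoℚ n
0≤ℕtoℚ n = nonNegative⁻¹ (ℕtoℚ n) {{normalize-nonNeg n 1}}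

*-monoˡ : ∀ {r p q} → 0ℚ ≤ r → p ≤ q → r * p ≤ r * q
*-monoˡ {r} 0≤r = *-monoˡ-≤-nonNeg r {{nonNegative 0≤r}}

*-monoʳ : ∀ {r p q} → 0ℚ ≤ r → p ≤ q → p * r ≤ q * r
*-monoʳ {r} 0≤r = *-monoʳ-≤-nonNeg r {{nonNegative 0≤r}}

0≤* : ∀ {p q} → 0ℚ ≤ p → 0ℚ ≤ q → 0ℚ ≤ p * q
0≤* {p} {q} 0≤p 0≤q = subst (_≤ p * q) (*-zeroʳ p) (*-monoˡ 0≤p 0≤q)

0<suc : ∀ n → 0ℚ < ℕtoℚ (suc n)
0<suc n = positive⁻¹ (ℕtoℚ (suc n)) {{normalize-pos (suc n) 1}}

cancel-pos : ∀ {r p q} → 0ℚ < r → p * r ≤ q * r → p ≤ q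
cancel-pos {r} 0<r = *-cancelʳ-≤-pos r {{positive 0<r}}

inverse : ∀ n → (+ 1 / suc n) * ℕtoℚ (suc n) ≡ 1ℚ
inverse n = toℚᵘ-injective (begin
  toℚᵘ ((+ 1 / suc n) * ℕtoℚ (suc n))                 ≈⟨ toℚᵘ-homo-* (+ 1 / suc n) (ℕtoℚ (suc n)) ⟩
  toℚᵘ (+ 1 / suc n) ℚᵘ.* toℚᵘ (ℕtoℚ (suc n))
    ≈⟨ ℚᵘ.*-cong (toℚᵘ-fromℚᵘ (ℚᵘ.mkℚᵘ (+ 1) n)) (toℚᵘ-ℕtoℚ (suc n)) ⟩
  ℚᵘ.mkℚᵘ (+ 1) n ℚᵘ.* ℚᵘ.mkℚᵘ (+ suc n) 0
    ≈⟨ ℚᵘ.*≡* (cong (λ x → + suc x) (trans (ℕ.*-identityʳ _)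
                                                           (sym (trans (ℕ.+-identityʳ _)
                                                               (trans (ℕ.*-identityʳ n)
                                                               (sym (ℕ.+-identityʳ n))))))) ⟩
  ℚᵘ.1ℚᵘ ∎)
  where
  open ℚᵘ.≃-Reasoning

-- Comparing the exponential series with powers of two

expTerm-suc : ∀ r k → expTerm r (suc k) * ℕtoℚ (suc k) ≡ expTerm r k * r
expTerm-suc r k = trans (*-assoc (expTerm r k * r) (+ 1 / suc k) (ℕtoℚ (suc k)))
  (trans (cong (expTerm r k * r *_) (inverse k)) (*-identityʳ _))

expTerm-nonNeg : ∀ {r} → 0ℚ ≤ r → ∀ k → 0ℚ ≤ expTerm r k
expTerm-nonNeg 0≤r zero    = 0≤ℕtoℚ 1
expTerm-nonNeg 0≤r (suc k) = 0≤* (0≤* (expTerm-nonNeg 0≤r k) 0≤r)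
    (nonNegative⁻¹ (+ 1 / suc k) {{normalize-nonNeg 1 (suc k)}})

expPartial-nonNeg : ∀ {r} → 0ℚ ≤ r → ∀ N → 0ℚ ≤ expPartial r N
expPartial-nonNeg 0≤r zero    = ≤-refl
expPartial-nonNeg 0≤r (suc N) = +-mono-≤ (expPartial-nonNeg 0≤r N) (expTerm-nonNeg 0≤r N)

2^ : ℕ → ℚ
2^ k = ℕtoℚ (2 ℕ.^ k)

2^-suc : ∀ k → 2^ (suc k) ≡ ℕtoℚ 2 * 2^ k
2^-suc k = ℕtoℚ-* 2 (2 ℕ.^ k)

-- Each factor `r / i` of the term, with `i ≤ k`, is at least 2.
2^≤expTerm : ∀ {r k} → 0ℚ ≤ r → ℕtoℚ 2 * ℕtoℚ k ≤ r → ∀ j → j ℕ.≤ k → 2^ j ≤ expTerm r j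
2^≤expTerm         0≤r 2k≤r zero    _   = ≤-refl
2^≤expTerm {r} {k} 0≤r 2k≤r (suc j) j<k = cancel-pos (0<suc j) (begin
  2^ (suc j) * ℕtoℚ (suc j)          ≡⟨ cong (_* ℕtoℚ (suc j)) (2^-suc j) ⟩
  ℕtoℚ 2 * 2^ j * ℕtoℚ (suc j)
    ≡⟨ solve 3 (λ a b c → a :* b :* c := b :* (a :* c)) refl (ℕtoℚ 2) (2^ j) (ℕtoℚ (suc j)) ⟩
  2^ j * (ℕtoℚ 2 * ℕtoℚ (suc j))
    ≤⟨ *-monoˡ (0≤ℕtoℚ (2 ℕ.^ j)) (≤-trans (*-monoˡ (0≤ℕtoℚ 2) (ℕtoℚ-mono j<k)) 2k≤r) ⟩
  2^ j * r                           ≤⟨ *-monoʳ 0≤r (2^≤expTerm 0≤r 2k≤r j (ℕ.<⇒≤ j<k)) ⟩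
  expTerm r j * r                    ≡⟨ expTerm-suc r j ⟨
  expTerm r (suc j) * ℕtoℚ (suc j)   ∎)
  where
  open ≤-Reasoning
  open +-*-Solver

2^≤exp : ∀ {r k} → 0ℚ ≤ r → ℕtoℚ 2 * ℕtoℚ k ≤ r → 2^ k ≤ expPartial r (suc k)
2^≤exp {r} {k} 0≤r 2k≤r = begin
  2^ k                          ≤⟨ 2^≤expTerm 0≤r 2k≤r k ℕ.≤-refl ⟩
  expTerm r k                   ≡⟨ +-identityˡ _ ⟨
  0ℚ + expTerm r k              ≤⟨ +-monoˡ-≤ (expTerm r k) (expPartial-nonNeg 0≤r k) ⟩
  expPartial r (suc k)          ∎
  where
  open ≤-Reasoning

-- The coefficients C(L+k−1, k) / 2ᵏ of (1 − 1/2)^(−L) = 2^L.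
coeff : ℕ → ℕ → ℚ
coeff _       zero    = 1ℚ
coeff zero    (suc k) = 0ℚ
coeff (suc L) (suc k) = coeff L (suc k) + ½ * coeff (suc L) k

coeffSum : ℕ → ℕ → ℚ
coeffSum L zero    = 0ℚ
coeffSum L (suc N) = coeffSum L N + coeff L N

-- The ratios of neighbouring coefficients in `k` and in `L`. Each feeds the other through the
-- recursion for `coeff`, so they are proved together.
coeff-suc  : ∀ k L → coeff L (suc k) * (ℕtoℚ 2 * ℕtoℚ (suc k)) ≡ coeff L k * (ℕtoℚ L + ℕtoℚ k)
coeff-sucˡ : ∀ k L → coeff L k * (ℕtoℚ L + ℕtoℚ k) ≡ coeff (suc L) k * ℕtoℚ L

coeff-suc zero    zero    = refl
coeff-suc (suc k) zero    = trans (*-zeroˡ (ℕtoℚ 2 * ℕtoℚ (suc (suc k))))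
    (sym (*-zeroˡ (ℕtoℚ 0 + ℕtoℚ (suc k))))
coeff-suc k       (suc L) = begin
  (a + ½ * b) * (ℕtoℚ 2 * s)
    ≡⟨ solve 3 (λ a b s → (a :+ con ½ :* b) :* (con (ℕtoℚ 2) :* s) := a :* (con (ℕtoℚ 2) :* s) :+ b :* s)
        refl a b s ⟩
  a * (ℕtoℚ 2 * s) + b * s              ≡⟨ cong (_+ b * s) (trans (coeff-suc k L) (coeff-sucˡ k L)) ⟩
  b * ℕtoℚ L + b * s                    ≡⟨ cong (λ s → b * ℕtoℚ L + b * s) (ℕtoℚ-+ 1 k) ⟩
  b * ℕtoℚ L + b * (1ℚ + ℕtoℚ k)
    ≡⟨ solve 3 (λ b L k → b :* L :+ b :* (con 1ℚ :+ k) := b :* ((con 1ℚ :+ L) :+ k)) refl b (ℕtoℚ L)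
        (ℕtoℚ k) ⟩
  b * ((1ℚ + ℕtoℚ L) + ℕtoℚ k)          ≡⟨ cong (λ x → b * (x + ℕtoℚ k)) (ℕtoℚ-+ 1 L) ⟨
  b * (ℕtoℚ (suc L) + ℕtoℚ k)           ∎
  where
  open ≡-Reasoning
  open +-*-Solver
  a = coeff L (suc k)
  b = coeff (suc L) k
  s = ℕtoℚ (suc k)

coeff-sucˡ zero    L = cong (1ℚ *_) (+-identityʳ (ℕtoℚ L))
coeff-sucˡ (suc k) L = begin
  a * (ℕtoℚ L + s)
    ≡⟨ solve 3 (λ a L s → a :* (L :+ s) := a :* L :+ con ½ :* (a :* (con (ℕtoℚ 2) :* s))) refl a
        (ℕtoℚ L) s ⟩
  a * ℕtoℚ L + ½ * (a * (ℕtoℚ 2 * s))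
    ≡⟨ cong (λ x → a * ℕtoℚ L + ½ * x) (trans (coeff-suc k L) (coeff-sucˡ k L)) ⟩
  a * ℕtoℚ L + ½ * (b * ℕtoℚ L)
    ≡⟨ solve 3 (λ a b L → a :* L :+ con ½ :* (b :* L) := (a :+ con ½ :* b) :* L) refl a b (ℕtoℚ L) ⟩
  (a + ½ * b) * ℕtoℚ L                      ∎
  where
  open ≡-Reasoning
  open +-*-Solver
  a = coeff L (suc k)
  b = coeff (suc L) k
  s = ℕtoℚ (suc k)

-- Consecutive terms have ratio `r / (k + 1)` on the left and `(L + k) / (2 (k + 1))` on the right,
-- and `2r ≤ L` makes the right one at least as large.
expTerm≤coeff : ∀ {r L} → 0ℚ ≤ r → r * ℕtoℚ 2 ≤ ℕtoℚ L → ∀ k → expTerm r k ≤ coeff L k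
expTerm≤coeff         0≤r 2r≤L zero    = ≤-refl
expTerm≤coeff {r} {L} 0≤r 2r≤L (suc k) = cancel-pos
    (subst (0ℚ <_) (ℕtoℚ-* 2 (suc k)) (0<suc (k ℕ.+ suc (k ℕ.+ 0)))) (begin
  expTerm r (suc k) * (ℕtoℚ 2 * s)
    ≡⟨ solve 3 (λ t a s → t :* (a :* s) := t :* s :* a) refl (expTerm r (suc k)) (ℕtoℚ 2) s ⟩
  expTerm r (suc k) * s * ℕtoℚ 2        ≡⟨ cong (_* ℕtoℚ 2) (expTerm-suc r k) ⟩
  expTerm r k * r * ℕtoℚ 2              ≡⟨ *-assoc (expTerm r k) r (ℕtoℚ 2) ⟩
  expTerm r k * (r * ℕtoℚ 2)            ≤⟨ *-monoʳ (0≤* 0≤r (0≤ℕtoℚ 2)) ih ⟩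
  coeff L k * (r * ℕtoℚ 2)              ≤⟨ *-monoˡ (≤-trans (expTerm-nonNeg 0≤r k) ih) 2r≤L+k ⟩
  coeff L k * (ℕtoℚ L + ℕtoℚ k)         ≡⟨ coeff-suc k L ⟨
  coeff L (suc k) * (ℕtoℚ 2 * s)        ∎)
  where
  open ≤-Reasoning
  open +-*-Solver
  s = ℕtoℚ (suc k)
  ih = expTerm≤coeff {r} {L} 0≤r 2r≤L k
  2r≤L+k : r * ℕtoℚ 2 ≤ ℕtoℚ L + ℕtoℚ k
  2r≤L+k = ≤-trans 2r≤L (subst (ℕtoℚ L ≤_) (ℕtoℚ-+ L k) (ℕtoℚ-mono (ℕ.m≤m+n L k)))

exp≤coeffSum : ∀ {r L} → 0ℚ ≤ r → r * ℕtoℚ 2 ≤ ℕtoℚ L → ∀ N → expPartial r N ≤ coeffSum L N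
exp≤coeffSum 0≤r 2r≤L zero    = ≤-refl
exp≤coeffSum {r} {L} 0≤r 2r≤L (suc N) = +-mono-≤ (exp≤coeffSum {r} {L} 0≤r 2r≤L N)
    (expTerm≤coeff {r} {L} 0≤r 2r≤L N)

-- For the generating functions this is `G (L + 1) = G L + (x / 2) G (L + 1)`, summed up to a given
-- degree.
coeffSum-suc : ∀ L N → coeffSum (suc L) (suc N) ≡ coeffSum L (suc N) + ½ * coeffSum (suc L) N
coeffSum-suc L zero    = refl
coeffSum-suc L (suc N) = trans (cong (_+ coeff (suc L) (suc N)) (coeffSum-suc L N))
  (solve 4 (λ p q a b → (p :+ con ½ :* q) :+ (a :+ con ½ :* b) := (p :+ a) :+ con ½ :* (q :+ b)) refl
     (coeffSum L (suc N)) (coeffSum (suc L) N) (coeff L (suc N)) (coeff (suc L) N))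
  where
  open +-*-Solver

-- Induction on both indices; the step adds half of `2^ (suc L)` to `2^ L`. No limit of the series
-- is needed.
coeffSum≤2^ : ∀ L N → coeffSum L N ≤ 2^ L
coeffSum≤2^ L       zero    = 0≤ℕtoℚ (2 ℕ.^ L)
coeffSum≤2^ zero    (suc N) = ≤-reflexive (ones N)
  where
  ones : ∀ N → coeffSum zero (suc N) ≡ 1ℚ
  ones zero    = refl
  ones (suc N) = trans (+-identityʳ _) (ones N)
coeffSum≤2^ (suc L) (suc N) = begin
  coeffSum (suc L) (suc N)                    ≡⟨ coeffSum-suc L N ⟩
  coeffSum L (suc N) + ½ * coeffSum (suc L) N
    ≤⟨ +-mono-≤ (coeffSum≤2^ L (suc N)) (*-monoˡ {½} (nonNegative⁻¹ ½) (coeffSum≤2^ (suc L) N)) ⟩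
  2^ L + ½ * 2^ (suc L)                       ≡⟨ cong (λ x → 2^ L + ½ * x) (2^-suc L) ⟩
  2^ L + ½ * (ℕtoℚ 2 * 2^ L)
    ≡⟨ solve 1 (λ x → x :+ con ½ :* (con (ℕtoℚ 2) :* x) := con (ℕtoℚ 2) :* x) refl (2^ L) ⟩
  ℕtoℚ 2 * 2^ L                               ≡⟨ 2^-suc L ⟨
  2^ (suc L)                                  ∎
  where
  open ≤-Reasoning
  open +-*-Solver

exp≤2^ : ∀ {r} L → 0ℚ ≤ r → r * ℕtoℚ 2 ≤ ℕtoℚ L → ∀ N → expPartial r N ≤ 2^ L
exp≤2^ L 0≤r 2r≤L N = ≤-trans (exp≤coeffSum {L = L} 0≤r 2r≤L N) (coeffSum≤2^ L N)

-- Integer parts and binary logarithms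

largest : (P : ℕ → Set) → (∀ j → Dec (P j)) → P 0 → ∀ b → ¬ P b → ∃ λ j → P j × ¬ P (suc j)
largest P P? P0 zero    ¬Pb = contradiction P0 ¬Pb
largest P P? P0 (suc b) ¬Pb with P? b
... | yes Pb  = b , Pb , ¬Pb
... | no ¬Pb′ = largest P P? P0 b ¬Pb′

n<2^n : ∀ n → n ℕ.< 2 ℕ.^ n
n<2^n zero    = s≤s z≤n
n<2^n (suc n) = ℕ.≤-trans (s≤s (n<2^n n)) (ℕ.≤-trans (ℕ.+-monoˡ-≤ (2 ℕ.^ n) (ℕ.m^n>0 2 n))
    (ℕ.≤-reflexive (cong (2 ℕ.^ n ℕ.+_) (sym (ℕ.+-identityʳ _)))))

log₂ : ∀ K n L₀ → 1ℚ ≤ K * ℕtoℚ 2 → K * 2^ L₀ ≤ ℕtoℚ n →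
       ∃ λ L → L₀ ℕ.≤ L × K * 2^ L ≤ ℕtoℚ n × ℕtoℚ n < K * 2^ (suc L)
log₂ K n L₀ 1≤2K base = j ℕ.+ L₀ , ℕ.m≤n+m L₀ j , proj₁ (proj₂ found) , ≰⇒> (proj₂ (proj₂ found))
  where
  0≤K : 0ℚ ≤ K
  0≤K = cancel-pos (0<suc 1) (≤-trans (≤-trans (≤-reflexive (*-zeroˡ (ℕtoℚ 2))) (0≤ℕtoℚ 1)) 1≤2K)
  -- Since `K ≥ 1/2`, the exponent `n + 1` already gives at least `2 ^ n > n`, which bounds the
  -- search.
  too-big : ¬ (K * 2^ (suc n ℕ.+ L₀) ≤ ℕtoℚ n)
  too-big ≤n = ℕ.<⇒≱ (n<2^n n) (ℕtoℚ-cancel (begin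
    2^ n                     ≡⟨ *-identityˡ (2^ n) ⟨
    1ℚ * 2^ n                ≤⟨ *-monoʳ (0≤ℕtoℚ (2 ℕ.^ n)) 1≤2K ⟩
    K * ℕtoℚ 2 * 2^ n        ≡⟨ trans (*-assoc K (ℕtoℚ 2) (2^ n)) (cong (K *_) (sym (2^-suc n))) ⟩
    K * 2^ (suc n)           ≤⟨ *-monoˡ 0≤K (ℕtoℚ-mono (ℕ.^-monoʳ-≤ 2 (ℕ.m≤m+n (suc n) L₀))) ⟩
    K * 2^ (suc n ℕ.+ L₀)    ≤⟨ ≤n ⟩
    ℕtoℚ n                   ∎))
    where
    open ≤-Reasoning
  found = largest (λ j → K * 2^ (j ℕ.+ L₀) ≤ ℕtoℚ n) (λ j → K * 2^ (j ℕ.+ L₀) ≤? ℕtoℚ n) base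
      (suc n) too-big
  j = proj₁ found

open Combinatorics using (module Grow; forcing-n-colours; forcing-many-colours)

-- The two bounds

<⇒≱ : ∀ {p q} → p < q → ¬ (q ≤ p)
<⇒≱ p<q q≤p = <-irrefl refl (<-≤-trans p<q q≤p)

-- The `n` edges at vertex `zero` have distinct colours, so `n ≤ M`; and `M` is at least 1. This
-- yields `K ≥ 1/2` for every `K` in the upper bound.
n≤2M : ∀ {n M} (col : Fin (suc n) → Fin (suc n) → Fin M) → Proper col → suc n ℕ.≤ M ℕ.* 2
n≤2M {n} {M} col proper = begin
  suc n        ≡⟨ ℕ.+-comm 1 n ⟩
  n ℕ.+ 1
    ≤⟨ ℕ.+-mono-≤ (Fin.injective⇒≤ star-injective) (ℕ.≤-trans (s≤s z≤n) (Fin.toℕ<n (col zero zero))) ⟩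
  M ℕ.+ M      ≡⟨ trans (cong (M ℕ.+_) (sym (ℕ.+-identityʳ M))) (ℕ.*-comm 2 M) ⟩
  M ℕ.* 2      ∎
  where
  open ℕ.≤-Reasoning
  star-injective : ∀ {i j} → col zero (suc i) ≡ col zero (suc j) → i ≡ j
  star-injective {i} {j} eq with i Fin.≟ j
  ... | yes i≡j = i≡j
  ... | no i≢j  = contradiction eq (proper zero (suc i) (suc j) (λ ()) (λ ()) (i≢j ∘ Fin.suc-injective))

-- Gives the integer part of `K / (d + 1)`: of `K` itself in the upper bound, of `K / 6` in the
-- lower bound.
floor : ∀ K n d → 0ℚ ≤ K → K ≤ ℕtoℚ n → ∃ λ j → ℕtoℚ (suc d ℕ.* j) ≤ K × K < ℕtoℚ (suc d ℕ.* suc j)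
floor K n d 0≤K K≤n = j , proj₁ (proj₂ found) , ≰⇒> (proj₂ (proj₂ found))
  where
  base : ℕtoℚ (suc d ℕ.* 0) ≤ K
  base = subst (λ z → ℕtoℚ z ≤ K) (sym (ℕ.*-zeroʳ (suc d))) 0≤K
  too-big : ¬ (ℕtoℚ (suc d ℕ.* suc n) ≤ K)
  too-big ≤K = ℕ.<-irrefl refl (ℕ.≤-trans (ℕ.m≤m+n (suc n) (d ℕ.* suc n)) (ℕtoℚ-cancel (≤-trans ≤K K≤n)))
  found = largest (λ j → ℕtoℚ (suc d ℕ.* j) ≤ K) (λ j → ℕtoℚ (suc d ℕ.* j) ≤? K) base (suc n) too-big
  j = proj₁ found

-- Upper bound

UpperBound : ℚ → Set
UpperBound C = (n : ℕ) (K : ℚ) → 0ℚ < K → K * ℕtoℚ 2 ≤ ℕtoℚ n →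
  (M : ℕ) (col : Fin n → Fin n → Fin M) →
  ℕtoℚ M ≤ K * ℕtoℚ n → Symmetric col → Proper col →
  Σ (Fin n → Fin n → Bool) λ T → IsSpanningTree T ×
  Σ (Subset M) λ S → CoversColours col T S ×
  LeMulLn (ℕtoℚ ∣ S ∣) (C * K) (ℕtoℚ n) K

module UpperBoundProof
  (n : ℕ) {{_ : ℕ.NonZero n}} (K : ℚ) (0<K : 0ℚ < K) (1≤2K : 1ℚ ≤ K * ℕtoℚ 2)
  (L : ℕ) (1≤L : 1 ℕ.≤ L) (K2^L≤n : K * 2^ L ≤ ℕtoℚ n) (n< : ℕtoℚ n < K * 2^ (suc L))
  (k′ : ℕ) (k′≤K : ℕtoℚ k′ ≤ K) (K≤k : K ≤ ℕtoℚ (suc k′))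
  where

  open ≤-Reasoning
  open +-*-Solver

  k : ℕ
  k = suc k′

  0≤K : 0ℚ ≤ K
  0≤K = <⇒≤ 0<K

  -- As `K ≥ 1/2`, the 1 added in rounding up is at most `2K`.
  k≤3K : ℕtoℚ k ≤ ℕtoℚ 3 * K
  k≤3K = begin
    ℕtoℚ k             ≡⟨ ℕtoℚ-+ 1 k′ ⟩
    1ℚ + ℕtoℚ k′       ≤⟨ +-mono-≤ 1≤2K k′≤K ⟩
    K * ℕtoℚ 2 + K     ≡⟨ solve 1 (λ k → k :* con (ℕtoℚ 2) :+ k := con (ℕtoℚ 3) :* k) refl K ⟩
    ℕtoℚ 3 * K         ∎

  M≤kn : ∀ M → ℕtoℚ M ≤ K * ℕtoℚ n → M ℕ.≤ k ℕ.* n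
  M≤kn M M≤Kn = ℕtoℚ-cancel (≤-trans M≤Kn (subst (K * ℕtoℚ n ≤_) (sym (ℕtoℚ-* k n))
      (*-monoʳ (0≤ℕtoℚ n) K≤k)))

  n≤2^k : n ℕ.≤ 2 ℕ.^ suc L ℕ.* k
  n≤2^k = ℕtoℚ-cancel (begin
    ℕtoℚ n                       ≤⟨ <⇒≤ n< ⟩
    K * 2^ (suc L)               ≤⟨ *-monoʳ (0≤ℕtoℚ (2 ℕ.^ suc L)) K≤k ⟩
    ℕtoℚ k * 2^ (suc L)          ≡⟨ *-comm (ℕtoℚ k) (2^ (suc L)) ⟩
    2^ (suc L) * ℕtoℚ k          ≡⟨ ℕtoℚ-* (2 ℕ.^ suc L) k ⟨
    ℕtoℚ (2 ℕ.^ suc L ℕ.* k)     ∎)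

  s≤10kL : ∀ s → s ℕ.≤ k ℕ.+ suc L ℕ.* (2 ℕ.* k) ℕ.+ suc L ℕ.* (2 ℕ.* k) ℕ.+ k → s ℕ.≤ 10 ℕ.* k ℕ.* L
  s≤10kL s s≤ = ℕ.≤-trans s≤ (ℕ.≤-trans
    (ℕ.≤-reflexive (N.solve 2 (λ k L → k N.:+ (N.con 1 N.:+ L) N.:* (N.con 2 N.:* k) N.:+
        (N.con 1 N.:+ L) N.:* (N.con 2 N.:* k) N.:+ k
                                N.:= N.con 6 N.:* k N.:* N.con 1 N.:+ N.con 4 N.:* k N.:* L) refl k L))
    (ℕ.≤-trans (ℕ.+-monoˡ-≤ (4 ℕ.* k ℕ.* L) (ℕ.*-monoʳ-≤ (6 ℕ.* k) 1≤L))
      (ℕ.≤-reflexive (N.solve 2 (λ k L → N.con 6 N.:* k N.:* L N.:+ N.con 4 N.:* k N.:* L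
                                  N.:= N.con 10 N.:* k N.:* L) refl k L))))
    where
    module N = ℕ.+-*-Solver

  s≤30KL : ∀ s → s ℕ.≤ 10 ℕ.* k ℕ.* L → ℕtoℚ s ≤ ℕtoℚ 30 * K * ℕtoℚ L
  s≤30KL s s≤ = begin
    ℕtoℚ s                                 ≤⟨ ℕtoℚ-mono s≤ ⟩
    ℕtoℚ (10 ℕ.* k ℕ.* L)                  ≡⟨ trans (ℕtoℚ-* (10 ℕ.* k) L) (cong (_* ℕtoℚ L) (ℕtoℚ-* 10 k)) ⟩
    ℕtoℚ 10 * ℕtoℚ k * ℕtoℚ L              ≤⟨ *-monoʳ (0≤ℕtoℚ L) (*-monoˡ (0≤ℕtoℚ 10) k≤3K) ⟩
    ℕtoℚ 10 * (ℕtoℚ 3 * K) * ℕtoℚ L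
      ≡⟨ cong (_* ℕtoℚ L) (trans (sym (*-assoc (ℕtoℚ 10) (ℕtoℚ 3) K)) (cong (_* K) (sym (ℕtoℚ-* 10 3)))) ⟩
    ℕtoℚ 30 * K * ℕtoℚ L                   ∎

  -- From `60 r K ≤ s ≤ 30 K L` follows `2r ≤ L`, so the exponential of `r` is at most
  -- `2 ^ L ≤ n / K`.
  leMulLn : ∀ s → ℕtoℚ s ≤ ℕtoℚ 30 * K * ℕtoℚ L → LeMulLn (ℕtoℚ s) (ℕtoℚ 60 * K) (ℕtoℚ n) K
  leMulLn s s≤ r 0≤r rCK≤ N = ≤-trans (*-monoˡ 0≤K (exp≤2^ L 0≤r 2r≤L N)) K2^L≤n
    where
    2r≤L : r * ℕtoℚ 2 ≤ ℕtoℚ L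
    2r≤L = cancel-pos {ℕtoℚ 30 * K} (subst (_< ℕtoℚ 30 * K) (*-zeroʳ (ℕtoℚ 30))
        (*-monoʳ-<-pos (ℕtoℚ 30) 0<K)) (begin
      r * ℕtoℚ 2 * (ℕtoℚ 30 * K)
        ≡⟨ solve 4 (λ r a b k → r :* a :* (b :* k) := r :* (a :* b :* k)) refl r (ℕtoℚ 2) (ℕtoℚ 30) K ⟩
      r * (ℕtoℚ 2 * ℕtoℚ 30 * K)      ≡⟨ cong (λ z → r * (z * K)) (sym (ℕtoℚ-* 2 30)) ⟩
      r * (ℕtoℚ 60 * K)               ≤⟨ rCK≤ ⟩
      ℕtoℚ s                          ≤⟨ s≤ ⟩
      ℕtoℚ 30 * K * ℕtoℚ L            ≡⟨ *-comm (ℕtoℚ 30 * K) (ℕtoℚ L) ⟩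
      ℕtoℚ L * (ℕtoℚ 30 * K)          ∎)

  spanning-tree : (M : ℕ) (col : Fin n → Fin n → Fin M) →
    ℕtoℚ M ≤ K * ℕtoℚ n → Symmetric col → Proper col →
    Σ (Fin n → Fin n → Bool) λ T → IsSpanningTree T ×
    Σ (Subset M) λ S → CoversColours col T S ×
    LeMulLn (ℕtoℚ ∣ S ∣) (ℕtoℚ 60 * K) (ℕtoℚ n) K
  spanning-tree M col M≤Kn col-sym proper = estimate
    (Grow.Phases.few-colours col col-sym proper (Fin.fromℕ< (ℕ.>-nonZero⁻¹ n)) k (M≤kn M M≤Kn)
        (ℕ.>-nonZero⁻¹ n) (suc L) n≤2^k)
    where
    estimate : (Σ (Fin n → Fin n → Bool) λ T → IsSpanningTree T × Σ (Subset M) λ S → CoversColours col T S ×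
                 ∣ S ∣ ℕ.≤ k ℕ.+ suc L ℕ.* (2 ℕ.* k) ℕ.+ suc L ℕ.* (2 ℕ.* k) ℕ.+ k) →
               Σ (Fin n → Fin n → Bool) λ T → IsSpanningTree T × Σ (Subset M) λ S → CoversColours col T S ×
                 LeMulLn (ℕtoℚ ∣ S ∣) (ℕtoℚ 60 * K) (ℕtoℚ n) K
    estimate (T , tree , S , covers , ∣S∣≤) = T , tree , S , covers , leMulLn ∣ S ∣
        (s≤30KL ∣ S ∣ (s≤10kL ∣ S ∣ ∣S∣≤))

1≤2K : ∀ {n M} K (col : Fin (suc n) → Fin (suc n) → Fin M) → Proper col →
       ℕtoℚ M ≤ K * ℕtoℚ (suc n) → 1ℚ ≤ K * ℕtoℚ 2
1≤2K {n} {M} K col proper M≤Kn = cancel-pos (0<suc n) (begin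
  1ℚ * ℕtoℚ (suc n)          ≡⟨ *-identityˡ (ℕtoℚ (suc n)) ⟩
  ℕtoℚ (suc n)               ≤⟨ ℕtoℚ-mono (n≤2M col proper) ⟩
  ℕtoℚ (M ℕ.* 2)             ≡⟨ ℕtoℚ-* M 2 ⟩
  ℕtoℚ M * ℕtoℚ 2            ≤⟨ *-monoʳ (0≤ℕtoℚ 2) M≤Kn ⟩
  K * ℕtoℚ (suc n) * ℕtoℚ 2
    ≡⟨ solve 3 (λ k n t → k :* n :* t := k :* t :* n) refl K (ℕtoℚ (suc n)) (ℕtoℚ 2) ⟩
  K * ℕtoℚ 2 * ℕtoℚ (suc n)  ∎)
  where
  open ≤-Reasoning
  open +-*-Solver

upperBound : UpperBound (ℕtoℚ 60)
upperBound zero K 0<K 2K≤0 = contradiction 2K≤0 (<⇒≱ (subst (_< K * ℕtoℚ 2) (*-zeroˡ (ℕtoℚ 2))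
  (*-monoˡ-<-pos (ℕtoℚ 2) 0<K)))
upperBound n@(suc n′) K 0<K 2K≤n M col M≤Kn col-sym proper =
  build (log₂ K n 1 (1≤2K K col proper M≤Kn) 2K≤n) (floor K n 0 (<⇒≤ 0<K) K≤n)
  where
  K≤n : K ≤ ℕtoℚ n
  K≤n = ≤-trans (subst (_≤ K * ℕtoℚ 2) (*-identityʳ K)
      (*-monoˡ (<⇒≤ 0<K) (ℕtoℚ-mono {1} {2} (s≤s z≤n)))) 2K≤n
  build : (∃ λ L → 1 ℕ.≤ L × K * 2^ L ≤ ℕtoℚ n × ℕtoℚ n < K * 2^ (suc L)) →
          (∃ λ k → ℕtoℚ (1 ℕ.* k) ≤ K × K < ℕtoℚ (1 ℕ.* suc k)) →
          Σ (Fin n → Fin n → Bool) λ T → IsSpanningTree T × Σ (Subset M) λ S → CoversColours col T S ×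
            LeMulLn (ℕtoℚ ∣ S ∣) (ℕtoℚ 60 * K) (ℕtoℚ n) K
  build (L , 1≤L , K2^L≤n , n<) (k , k≤K , K<1+k) =
    UpperBoundProof.spanning-tree n K 0<K (1≤2K K col proper M≤Kn) L 1≤L K2^L≤n n<
      k (subst (λ z → ℕtoℚ z ≤ K) (ℕ.*-identityˡ k) k≤K)
      (<⇒≤ (subst (λ z → K < ℕtoℚ z) (ℕ.*-identityˡ (suc k)) K<1+k)) M col M≤Kn col-sym proper

-- Both constructions give 4 L K ≤ 768 |S|, where r ≤ 2 (L + 1) ≤ 4 L for every r with K eʳ ≤ n.
c₀ : ℚ
c₀ = + 1 / 768

mulLnLe : ∀ K n L s → 0ℚ ≤ K → 1 ℕ.≤ L → ℕtoℚ n < K * 2^ (suc L) →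
          ℕtoℚ 4 * ℕtoℚ L * K ≤ ℕtoℚ s * ℕtoℚ 768 → MulLnLe (c₀ * K) (ℕtoℚ n) K (ℕtoℚ s)
mulLnLe K n L s 0≤K 1≤L n< 4LK≤ r 0≤r exp≤ = cancel-pos (0<suc 767) (begin
  r * (c₀ * K) * ℕtoℚ 768
    ≡⟨ solve 4 (λ r c k w → r :* (c :* k) :* w := r :* k :* (c :* w)) refl r c₀ K (ℕtoℚ 768) ⟩
  r * K * (c₀ * ℕtoℚ 768)             ≡⟨ trans (cong (r * K *_) (inverse 767)) (*-identityʳ (r * K)) ⟩
  r * K                               ≤⟨ *-monoʳ 0≤K (≤-trans r≤ 2[1+L]≤4L) ⟩
  ℕtoℚ 4 * ℕtoℚ L * K                 ≤⟨ 4LK≤ ⟩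
  ℕtoℚ s * ℕtoℚ 768                   ∎)
  where
  open ≤-Reasoning
  open +-*-Solver
  -- Otherwise a partial sum of the series would reach `2 ^ (L + 1)`, which exceeds `n / K`.
  r≤ : r ≤ ℕtoℚ 2 * ℕtoℚ (suc L)
  r≤ = [ id , (λ ≤r → contradiction (≤-trans (*-monoˡ 0≤K (2^≤exp {r} {suc L} 0≤r ≤r))
      (exp≤ (suc (suc L)))) (<⇒≱ n<)) ]′
         (≤-total r (ℕtoℚ 2 * ℕtoℚ (suc L)))
  2[1+L]≤4L : ℕtoℚ 2 * ℕtoℚ (suc L) ≤ ℕtoℚ 4 * ℕtoℚ L
  2[1+L]≤4L = subst₂ _≤_ (ℕtoℚ-* 2 (suc L)) (ℕtoℚ-* 4 L) (ℕtoℚ-mono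
    (ℕ.≤-trans (ℕ.*-monoʳ-≤ 2 (ℕ.+-monoˡ-≤ L 1≤L))
        (ℕ.≤-reflexive (N.solve 1 (λ L → N.con 2 N.:* (L N.:+ L) N.:= N.con 4 N.:* L) refl L))))
    where
    module N = ℕ.+-*-Solver

-- Choice of parameters in the lower bound

^ℚ-ℕtoℚ : ∀ m j → ℕtoℚ m ^ℚ j ≡ ℕtoℚ (m ℕ.^ j)
^ℚ-ℕtoℚ m zero    = refl
^ℚ-ℕtoℚ m (suc j) = trans (cong (_* ℕtoℚ m) (^ℚ-ℕtoℚ m j))
    (trans (*-comm (ℕtoℚ (m ℕ.^ j)) (ℕtoℚ m)) (sym (ℕtoℚ-* m (m ℕ.^ j))))

-- The hypothesis is taken at `r = 4`, where `e^4 ≤ 2^8 ≤ n` and `4^8 = 2^16`. It makes the binary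
-- logarithm `L` of `n / K` at least 16.
K*2^16≤n : ∀ n K → 256 ℕ.≤ n → LnPow8Le (ℕtoℚ n) (ℕtoℚ n) K → K * 2^ 16 ≤ ℕtoℚ n
K*2^16≤n n K 256≤n hyp = subst (λ z → K * z ≤ ℕtoℚ n) (^ℚ-ℕtoℚ 4 8) (hyp (ℕtoℚ 4) (0≤ℕtoℚ 4) e⁴≤n)
  where
  e⁴≤n : ExpLE (ℕtoℚ 4) (ℕtoℚ n) 1ℚ
  e⁴≤n N = subst (_≤ ℕtoℚ n) (sym (*-identityˡ (expPartial (ℕtoℚ 4) N)))
    (≤-trans (exp≤2^ 8 (0≤ℕtoℚ 4) (≤-reflexive (sym (ℕtoℚ-* 4 2))) N) (ℕtoℚ-mono 256≤n))

Forcing : ℕ → ℚ → Set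
Forcing n K = Σ ℕ λ M → Σ (Fin n → Fin n → Fin M) λ col →
  ℕtoℚ M ≤ K * ℕtoℚ n × Symmetric col × Proper col ×
  ((T : Fin n → Fin n → Bool) → IsSpanningTree T →
  (S : Subset M) → CoversColours col T S →
  MulLnLe (c₀ * K) (ℕtoℚ n) K (ℕtoℚ ∣ S ∣))

-- The remainder is below `d`, hence at most one more quotient's worth: rounding `L / d` down loses
-- at most a factor 2.
L≤[L/d]2d : ∀ L d {{_ : ℕ.NonZero d}} → 1 ℕ.≤ L ℕ./ d → L ℕ.≤ (L ℕ./ d) ℕ.* (2 ℕ.* d)
L≤[L/d]2d L d 1≤ = begin
  L                                   ≡⟨ ℕ.m≡m%n+[m/n]*n L d ⟩
  L ℕ.% d ℕ.+ q ℕ.* d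
    ≤⟨ ℕ.+-monoˡ-≤ (q ℕ.* d) (ℕ.≤-trans (ℕ.<⇒≤ (ℕ.m%n<n L d))
        (ℕ.≤-trans (ℕ.≤-reflexive (sym (ℕ.*-identityˡ d))) (ℕ.*-monoˡ-≤ d 1≤))) ⟩
  q ℕ.* d ℕ.+ q ℕ.* d                 ≡⟨ solve 2 (λ q d → q :* d :+ q :* d := q :* (con 2 :* d)) refl q d ⟩
  q ℕ.* (2 ℕ.* d)                     ∎
  where
  open ℕ.≤-Reasoning
  open ℕ.+-*-Solver
  q = L ℕ./ d

module LowerBoundProof (n : ℕ) (K : ℚ) (1≤K : 1ℚ ≤ K) (L : ℕ) (16≤L : 16 ℕ.≤ L)
  (K2^L≤n : K * 2^ L ≤ ℕtoℚ n) (n< : ℕtoℚ n < K * 2^ (suc L)) where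

  0≤K : 0ℚ ≤ K
  0≤K = ≤-trans (0≤ℕtoℚ 1) 1≤K

  1≤L : 1 ℕ.≤ L
  1≤L = ℕ.≤-trans (s≤s z≤n) 16≤L

  conclude : ∀ B s → K ≤ ℕtoℚ B → 4 ℕ.* L ℕ.* B ℕ.≤ s ℕ.* 768 → MulLnLe (c₀ * K) (ℕtoℚ n) K (ℕtoℚ s)
  conclude B s K≤B 4LB≤ = mulLnLe K n L s 0≤K 1≤L n< (begin
    ℕtoℚ 4 * ℕtoℚ L * K           ≤⟨ *-monoˡ (0≤* (0≤ℕtoℚ 4) (0≤ℕtoℚ L)) K≤B ⟩
    ℕtoℚ 4 * ℕtoℚ L * ℕtoℚ B      ≡⟨ trans (ℕtoℚ-* (4 ℕ.* L) B) (cong (_* ℕtoℚ B) (ℕtoℚ-* 4 L)) ⟨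
    ℕtoℚ (4 ℕ.* L ℕ.* B)          ≤⟨ ℕtoℚ-mono 4LB≤ ⟩
    ℕtoℚ (s ℕ.* 768)              ≡⟨ ℕtoℚ-* s 768 ⟩
    ℕtoℚ s * ℕtoℚ 768             ∎)
    where
    open ≤-Reasoning

  2^L≤n : ∀ k → ℕtoℚ k ≤ K → k ℕ.* 2 ℕ.^ L ℕ.≤ n
  2^L≤n k k≤K = ℕtoℚ-cancel (≤-trans (≤-reflexive (ℕtoℚ-* k (2 ℕ.^ L)))
      (≤-trans (*-monoʳ (0≤ℕtoℚ (2 ℕ.^ L)) k≤K) K2^L≤n))

  small-K : K < ℕtoℚ 6 → Forcing n K
  small-K K<6 = n , col , n≤Kn , proj₁ (proj₂ forcing) , proj₁ (proj₂ (proj₂ forcing)) ,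
    λ T tree S covers → conclude 6 ∣ S ∣ (<⇒≤ K<6)
        (enough ∣ S ∣ (proj₂ (proj₂ (proj₂ forcing)) T tree S covers))
    where
    open ℕ.≤-Reasoning
    open ℕ.+-*-Solver
    -- With `D ≤ 2 ^ (2e + 3)`, the size condition follows once `n` is at least 2 to the power
    -- `4e + 7`, and `4e + 7 ≤ 8e ≤ L` because `e ≥ 2`.
    e = L ℕ./ 8
    D = 3 ℕ.^ e ℕ.* 6
    x = 2 ℕ.* e ℕ.+ 3
    2≤e : 2 ℕ.≤ e
    2≤e = ℕ./-monoˡ-≤ 8 16≤L
    D≤2^x : D ℕ.≤ 2 ℕ.^ x
    D≤2^x = ℕ.≤-trans (ℕ.*-mono-≤ (ℕ.^-monoˡ-≤ e {3} {4} (ℕ.n≤1+n 3)) (ℕ.m≤m+n 6 2))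
      (ℕ.≤-reflexive (trans (cong (ℕ._* 8) (ℕ.^-*-assoc 2 2 e)) (sym (ℕ.^-distribˡ-+-* 2 (2 ℕ.* e) 3))))
    2≤D : 2 ℕ.≤ D
    2≤D = ℕ.≤-trans (ℕ.m≤m+n 2 4) (ℕ.m≤n*m 6 (3 ℕ.^ e) {{ℕ.m^n≢0 3 e}})
    1+x+x≤L : suc (x ℕ.+ x) ℕ.≤ L
    1+x+x≤L = begin
      suc (x ℕ.+ x)
        ≡⟨ solve 1 (λ e → con 1 :+ (con 2 :* e :+ con 3 :+ (con 2 :* e :+ con 3)) := con 4 :* e :+ con 7)
            refl e ⟩
      4 ℕ.* e ℕ.+ 7              ≤⟨ ℕ.+-monoʳ-≤ (4 ℕ.* e) (ℕ.≤-trans (ℕ.n≤1+n 7) (ℕ.*-monoʳ-≤ 4 2≤e)) ⟩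
      4 ℕ.* e ℕ.+ 4 ℕ.* e        ≡⟨ solve 1 (λ e → con 4 :* e :+ con 4 :* e := e :* con 8) refl e ⟩
      e ℕ.* 8                    ≤⟨ ℕ.m/n*n≤m L 8 ⟩
      L                          ∎
    D-small : suc (D ℕ.+ D ℕ.* D) ℕ.≤ n
    D-small = begin
      suc D ℕ.+ D ℕ.* D
        ≤⟨ ℕ.+-monoˡ-≤ (D ℕ.* D) (ℕ.≤-trans (ℕ.+-monoˡ-≤ D (ℕ.≤-trans (s≤s z≤n) 2≤D))
                                             (ℕ.≤-trans (ℕ.≤-reflexive
                                                 (solve 1 (λ D → D :+ D := con 2 :* D) refl D))
                                                 (ℕ.*-monoˡ-≤ D 2≤D))) ⟩
      D ℕ.* D ℕ.+ D ℕ.* D               ≤⟨ ℕ.+-mono-≤ (ℕ.*-mono-≤ D≤2^x D≤2^x) (ℕ.*-mono-≤ D≤2^x D≤2^x) ⟩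
      2 ℕ.^ x ℕ.* 2 ℕ.^ x ℕ.+ 2 ℕ.^ x ℕ.* 2 ℕ.^ x
                                        ≡⟨ cong (λ z → z ℕ.+ z) (sym (ℕ.^-distribˡ-+-* 2 x x)) ⟩
      2 ℕ.^ (x ℕ.+ x) ℕ.+ 2 ℕ.^ (x ℕ.+ x) ≡⟨ cong (2 ℕ.^ (x ℕ.+ x) ℕ.+_) (sym (ℕ.+-identityʳ _)) ⟩
      2 ℕ.^ suc (x ℕ.+ x)               ≤⟨ ℕ.^-monoʳ-≤ 2 1+x+x≤L ⟩
      2 ℕ.^ L                           ≡⟨ ℕ.*-identityˡ (2 ℕ.^ L) ⟨
      1 ℕ.* 2 ℕ.^ L                     ≤⟨ 2^L≤n 1 1≤K ⟩
      n                                 ∎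
    forcing = forcing-n-colours e n D-small
    col = proj₁ forcing
    n≤Kn : ℕtoℚ n ≤ K * ℕtoℚ n
    n≤Kn = subst (_≤ K * ℕtoℚ n) (*-identityˡ (ℕtoℚ n)) (*-monoʳ (0≤ℕtoℚ n) 1≤K)
    enough : ∀ s → e ℕ.≤ s → 4 ℕ.* L ℕ.* 6 ℕ.≤ s ℕ.* 768
    enough s e≤s = begin
      4 ℕ.* L ℕ.* 6           ≡⟨ solve 1 (λ L → con 4 :* L :* con 6 := L :* con 24) refl L ⟩
      L ℕ.* 24                ≤⟨ ℕ.*-monoˡ-≤ 24 (L≤[L/d]2d L 8 (ℕ.≤-trans (s≤s z≤n) 2≤e)) ⟩
      e ℕ.* 16 ℕ.* 24         ≡⟨ ℕ.*-assoc e 16 24 ⟩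
      e ℕ.* 384               ≤⟨ ℕ.*-mono-≤ e≤s (ℕ.m≤m+n 384 384) ⟩
      s ℕ.* 768               ∎

  large-K : ∀ k → {{ℕ.NonZero k}} → ℕtoℚ (6 ℕ.* k) ≤ K → K < ℕtoℚ (6 ℕ.* suc k) → Forcing n K
  large-K k 6k≤K K< = M , col , M≤Kn , sym-col , proper ,
    λ T tree S covers → conclude (6 ℕ.* suc k) ∣ S ∣ (<⇒≤ K<) (enough ∣ S ∣ (forces T tree S covers))
    where
    open ℕ.≤-Reasoning
    open ℕ.+-*-Solver
    -- The labels need `3h` bits and the `h < 2 ^ h` offsets at most `h` more, in total `4h ≤ L`.
    h = L ℕ./ 4
    1≤h : 1 ℕ.≤ h
    1≤h = ℕ.≤-trans (s≤s z≤n) (ℕ./-monoˡ-≤ 4 16≤L)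
    instance
      h≢0 : ℕ.NonZero h
      h≢0 = ℕ.>-nonZero 1≤h
    k≤K : ℕtoℚ k ≤ K
    k≤K = ≤-trans (ℕtoℚ-mono (ℕ.m≤n*m k 6)) 6k≤K
    fits : 2 ℕ.^ (h ℕ.+ (h ℕ.+ h)) ℕ.* (k ℕ.* h) ℕ.≤ n
    fits = begin
      2 ℕ.^ (h ℕ.+ (h ℕ.+ h)) ℕ.* (k ℕ.* h)
        ≤⟨ ℕ.*-monoʳ-≤ (2 ℕ.^ (h ℕ.+ (h ℕ.+ h))) (ℕ.*-monoʳ-≤ k (ℕ.<⇒≤ (n<2^n h))) ⟩
      2 ℕ.^ (h ℕ.+ (h ℕ.+ h)) ℕ.* (k ℕ.* 2 ℕ.^ h)
        ≡⟨ solve 3 (λ a k b → a :* (k :* b) := k :* (a :* b)) refl (2 ℕ.^ (h ℕ.+ (h ℕ.+ h))) k (2 ℕ.^ h) ⟩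
      k ℕ.* (2 ℕ.^ (h ℕ.+ (h ℕ.+ h)) ℕ.* 2 ℕ.^ h)
        ≡⟨ cong (k ℕ.*_) (sym (ℕ.^-distribˡ-+-* 2 (h ℕ.+ (h ℕ.+ h)) h)) ⟩
      k ℕ.* 2 ℕ.^ (h ℕ.+ (h ℕ.+ h) ℕ.+ h)            ≤⟨ ℕ.*-monoʳ-≤ k (ℕ.^-monoʳ-≤ 2 (ℕ.≤-trans
                                                          (ℕ.≤-reflexive (solve 1
                                                              (λ h → h :+ (h :+ h) :+ h := h :* con 4)
                                                              refl h)) (ℕ.m/n*n≤m L 4))) ⟩
      k ℕ.* 2 ℕ.^ L                                  ≤⟨ 2^L≤n k k≤K ⟩
      n                                              ∎
    forcing = forcing-many-colours k h n fits
    M        = proj₁ forcing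
    col      = proj₁ (proj₂ forcing)
    sym-col  = proj₁ (proj₂ (proj₂ (proj₂ forcing)))
    proper   = proj₁ (proj₂ (proj₂ (proj₂ (proj₂ forcing))))
    forces   = proj₂ (proj₂ (proj₂ (proj₂ (proj₂ forcing))))
    M≤Kn : ℕtoℚ M ≤ K * ℕtoℚ n
    M≤Kn = ≤-trans (ℕtoℚ-mono (proj₁ (proj₂ (proj₂ forcing))))
             (≤-trans (≤-reflexive (ℕtoℚ-* (6 ℕ.* k) n)) (*-monoʳ (0≤ℕtoℚ n) 6k≤K))
    -- From `L ≤ 8h` and `k + 1 ≤ 2k` the left side is at most `384 k h`; that each colour serves
    -- two blocks doubles the constant to 768.
    enough : ∀ s → k ℕ.* suc h ℕ.≤ 2 ℕ.* s → 4 ℕ.* L ℕ.* (6 ℕ.* suc k) ℕ.≤ s ℕ.* 768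
    enough s kh≤2s = begin
      4 ℕ.* L ℕ.* (6 ℕ.* suc k)           ≤⟨ ℕ.*-mono-≤ (ℕ.*-monoʳ-≤ 4 (L≤[L/d]2d L 4 1≤h))
                                               (ℕ.*-monoʳ-≤ 6 (ℕ.+-monoˡ-≤ k (ℕ.>-nonZero⁻¹ k))) ⟩
      4 ℕ.* (h ℕ.* 8) ℕ.* (6 ℕ.* (k ℕ.+ k))
        ≡⟨ solve 2 (λ h k → con 4 :* (h :* con 8) :* (con 6 :* (k :+ k)) := k :* h :* con 384) refl h k ⟩
      k ℕ.* h ℕ.* 384                     ≤⟨ ℕ.*-monoˡ-≤ 384 (ℕ.≤-trans (ℕ.*-monoʳ-≤ k (ℕ.n≤1+n h)) kh≤2s) ⟩
      2 ℕ.* s ℕ.* 384                     ≡⟨ solve 1 (λ s → con 2 :* s :* con 384 := s :* con 768) refl s ⟩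
      s ℕ.* 768                           ∎

lowerBound : (n : ℕ) → 256 ℕ.≤ n → (K : ℚ) → 1ℚ ≤ K → LnPow8Le (ℕtoℚ n) (ℕtoℚ n) K → Forcing n K
lowerBound n 256≤n K 1≤K hyp = scale (log₂ K n 16 1≤2K′ (K*2^16≤n n K 256≤n hyp))
  where
  0≤K : 0ℚ ≤ K
  0≤K = ≤-trans (0≤ℕtoℚ 1) 1≤K
  1≤2K′ : 1ℚ ≤ K * ℕtoℚ 2
  1≤2K′ = ≤-trans 1≤K (subst (_≤ K * ℕtoℚ 2) (*-identityʳ K) (*-monoˡ 0≤K (ℕtoℚ-mono {1} {2} (s≤s z≤n))))
  scale : (∃ λ L → 16 ℕ.≤ L × K * 2^ L ≤ ℕtoℚ n × ℕtoℚ n < K * 2^ (suc L)) → Forcing n K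
  -- Multiples of six are used because `k` blocks take up to `6 k n` colours; no block fits when
  -- `K < 6`.
  scale (L , 16≤L , K2^L≤n , n<) = split (floor K n 5 0≤K K≤n)
    where
    open LowerBoundProof n K 1≤K L 16≤L K2^L≤n n< using (small-K; large-K)
    K≤n : K ≤ ℕtoℚ n
    K≤n = ≤-trans (subst (_≤ K * 2^ L) (*-identityʳ K) (*-monoˡ 0≤K (ℕtoℚ-mono (ℕ.m^n>0 2 L)))) K2^L≤n
    split : (∃ λ k → ℕtoℚ (6 ℕ.* k) ≤ K × K < ℕtoℚ (6 ℕ.* suc k)) → Forcing n K
    split (zero  , _ , K<6)   = small-K K<6
    split (suc k , 6k≤K , K<) = large-K (suc k) 6k≤K K<

theorem1p5 : (Σ ℚ λ C → 0ℚ < C ×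
    ((n : ℕ) (K : ℚ) → 0ℚ < K → K * ℕtoℚ 2 ≤ ℕtoℚ n →
    (M : ℕ) (col : Fin n → Fin n → Fin M) →
    ℕtoℚ M ≤ K * ℕtoℚ n → Symmetric col → Proper col →
    Σ (Fin n → Fin n → Bool) λ T → IsSpanningTree T ×
    Σ (Subset M) λ S → CoversColours col T S ×
    LeMulLn (ℕtoℚ ∣ S ∣) (C * K) (ℕtoℚ n) K))
    ×
    (Σ ℚ λ c → 0ℚ < c × Σ ℕ λ N₀ →
    ((n : ℕ) → N₀ Data.Nat.≤ n → (K : ℚ) → 1ℚ ≤ K →
    LnPow8Le (ℕtoℚ n) (ℕtoℚ n) K →
    Σ ℕ λ M → Σ (Fin n → Fin n → Fin M) λ col →
    ℕtoℚ M ≤ K * ℕtoℚ n × Symmetric col × Proper col ×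
    ((T : Fin n → Fin n → Bool) → IsSpanningTree T →
    (S : Subset M) → CoversColours col T S →
    MulLnLe (c * K) (ℕtoℚ n) K (ℕtoℚ ∣ S ∣))))
theorem1p5 = (ℕtoℚ 60 , 0<suc 59 , upperBound) , (c₀ , positive⁻¹ c₀ , 256 , lowerBound)
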